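{- For every sufficiently large integer $n$, \[ 0.03125 \leq \mathbf{d}(Q_n, C_6, C_4) \leq 0.1625. \]
   Context: $Q_n$ denotes the $n$-dimensional hypercube: its vertices are the binary vectors of length $n$, two vectors being adjacent iff they differ in exactly one coordinate. $C_m$ is the cycle on $m$ vertices. For graphs $G$ and $T$, a copy of $T$ in $G$ is a subgraph of $G$ isomorphic to $T$, and $N(G,T)$ is the number of copies of $T$ in $G$. A graph is $H$-free if it has no subgraph isomorphic to $H$. For subgraphs $T,H$ of $G$, $\mathrm{ex}(G,T,H)=\max\{N(G',T): G'\subseteq G,\ G' \text{ is } H\text{ -free}\}$ and $\mathbf{d}(G,T,H)=\mathrm{ex}(G,T,H)/N(G,T)$. -}

module Defs where

open import Data.Bool using (Bool; true; false; _∧_; _∨_; not; if_then_else_)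
import Data.Bool as B
open import Data.Nat using (ℕ; zero; suc; _⊔_; _≡ᵇ_)
open import Data.Fin using (Fin)
open import Data.List using (List; []; _∷_; map; concatMap; filterᵇ; length; foldr; allFin; _++_)
open import Data.Bool.ListAction using (all; any)
open import Data.Vec using (Vec; lookup; updateAt)
import Data.Vec
open import Data.Vec.Properties using (≡-dec)
open import Data.Product using (_×_; _,_; proj₁; proj₂)
open import Relation.Nullary.Decidable using (does)

Vertex : ℕ → Set
Vertex n = Vec Bool n

allVertices : (n : ℕ) → List (Vertex n)
allVertices zero = Data.Vec.[] ∷ []
allVertices (suc n) =
  concatMap (λ v → (false Data.Vec.∷ v) ∷ (true Data.Vec.∷ v) ∷ []) (allVertices n)

_==_ : {n : ℕ} → Vertex n → Vertex n → Bool
u == v = does (≡-dec B._≟_ u v)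

flipAt : {n : ℕ} → Fin n → Vertex n → Vertex n
flipAt i v = updateAt v i not

-- An (undirected) edge, stored as a pair of endpoints.
Edge : ℕ → Set
Edge n = Vertex n × Vertex n

-- Graphs on the vertex set of Q_n are given by their edge lists.
-- Edge list of Q_n: every edge {u, u + e_i} listed exactly once, as
-- (u , u with coordinate i flipped) where u_i = 0.
cubeEdges : (n : ℕ) → List (Edge n)
cubeEdges n =
  concatMap (λ u → concatMap (λ i → if lookup u i then [] else ((u , flipAt i u) ∷ []))
                             (allFin n))
            (allVertices n)

sublists : {A : Set} → List A → List (List A)
sublists [] = [] ∷ []
sublists (x ∷ xs) = sublists xs ++ map (x ∷_) (sublists xs)

hasEdge : {n : ℕ} → List (Edge n) → Vertex n → Vertex n → Bool
hasEdge F u v =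
  any (λ e → ((proj₁ e == u) ∧ (proj₂ e == v)) ∨ ((proj₁ e == v) ∧ (proj₂ e == u))) F

tuples : {A : Set} → ℕ → List A → List (List A)
tuples zero xs = [] ∷ []
tuples (suc k) xs = concatMap (λ x → map (x ∷_) (tuples k xs)) xs

distinct : {n : ℕ} → List (Vertex n) → Bool
distinct [] = true
distinct (x ∷ xs) = not (any (x ==_) xs) ∧ distinct xs

cyclicPairs : {A : Set} → List A → List (A × A)
cyclicPairs [] = []
cyclicPairs (x ∷ xs) = go (x ∷ xs)
  where
  go : _ → List (_ × _)
  go [] = []
  go (a ∷ []) = (a , x) ∷ []
  go (a ∷ b ∷ r) = (a , b) ∷ go (b ∷ r)

endpoints : {n : ℕ} → List (Edge n) → List (Vertex n)
endpoints F = concatMap (λ e → proj₁ e ∷ proj₂ e ∷ []) F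

-- For m ≥ 3: the edge set F (together with its endpoints) forms a copy of C_m,
-- i.e. F consists of exactly m edges and there are m distinct vertices
-- w_0,…,w_{m-1} with {w_i, w_{i+1 mod m}} ∈ F for all i.
isCycle : {n : ℕ} → ℕ → List (Edge n) → Bool
isCycle m F =
  (length F ≡ᵇ m) ∧
  any (λ w → distinct w ∧ all (λ p → hasEdge F (proj₁ p) (proj₂ p)) (cyclicPairs w))
      (tuples m (endpoints F))

-- N(G, C_m): number of copies of C_m in the graph with edge list G.
-- (A copy of a cycle is determined by its edge set; copies = sub-edge-sets forming C_m.)
numCycles : {n : ℕ} → ℕ → List (Edge n) → ℕ
numCycles m G = length (filterᵇ (isCycle m) (sublists G))

cycleFree : {n : ℕ} → ℕ → List (Edge n) → Bool
cycleFree k G' = numCycles k G' ≡ᵇ 0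

exCycle : {n : ℕ} → ℕ → ℕ → List (Edge n) → ℕ
exCycle m k G = foldr _⊔_ 0 (map (numCycles m) (filterᵇ (cycleFree k) (sublists G)))

{-# OPTIONS --safe #-}

-- Every 6-cycle of Q_n lies in a 3-dimensional subcube, where its direction word is, up to
-- renaming, one of four; hence the copies of C₆, each traversed 12 times, are counted by tuples
-- (word, ordered triple of directions, starting vertex).
-- Lower bound: the edges between levels 2k and 2k+1, and likewise those between levels 2k+1 and
-- 2k+2, form a C₄-free graph. Each Q₃ (which has 16 hexagons) contains exactly one hexagon of
-- exactly one of these two graphs, so one of them has at least 1/32 of all hexagons.
-- Upper bound: a C₄-free subgraph of Q₃ has at most half as many hexagons as vertices of degree 2
-- (a check of all 2¹² subgraphs). Summed over all Q₃, the vertices of degree 2 number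
-- Σ_v C(d(v),2)(n - d(v)), and 5d²(n-d) ≤ n³.
module Submission where

open import Defs
open import Data.Nat using (ℕ; _≤_; _*_)
open import Data.Product using (_×_; ∃-syntax)

open import Data.Bool using (Bool; true; false; T; T?; _∧_; _∨_; _xor_; not; if_then_else_)
import Data.Bool as B
open import Data.Bool.ListAction using (all; any)
open import Data.Bool.Properties using (T-∧; T-∨; T-≡; not-involutive; not-¬)
open import Data.Empty using (⊥-elim)
open import Data.Fin using (Fin; zero; suc; #_)
import Data.Fin.Properties as Fin
open import Data.List
  using (List; []; _∷_; map; filterᵇ; length; _++_; concatMap; lookup; allFin; foldr; cartesianProduct; take; drop; reverse; upTo)
open import Data.List.Membership.DecPropositional using () renaming (_∈?_ to member?)
open import Data.List.Membership.Propositional using (_∈_; _∉_; find; lose)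
open import Data.List.Membership.Propositional.Properties
  using (∈-∃++; ∈-++⁻; ∈-++⁺ˡ; ∈-++⁺ʳ; ∈-map⁺; ∈-map⁻; ∈-concatMap⁺; ∈-concatMap⁻; ∈-filter⁺; ∈-filter⁻
        ; ∈-lookup; ∈-allFin; ∈-cartesianProduct⁺; ∈-cartesianProduct⁻)
import Data.List.Properties as List
open import Data.List.Properties using (map-++; map-∘; length-++; ∷-injective; ∷-injectiveʳ; length-map; length-tabulate)
open import Data.List.Relation.Binary.Pointwise using (Pointwise; []; _∷_; Pointwise-length)
open import Data.List.Relation.Binary.Subset.Propositional using (_⊆_)
open import Data.List.Relation.Unary.All using (All; []; _∷_)
import Data.List.Relation.Unary.All as All
import Data.List.Relation.Unary.All.Properties as AllP
open import Data.List.Relation.Unary.AllPairs using (AllPairs; []; _∷_; allPairs?)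
import Data.List.Relation.Unary.AllPairs as AllPairs
import Data.List.Relation.Unary.AllPairs.Properties as AllPairsP
open import Data.List.Relation.Unary.Any using (Any; here; there)
import Data.List.Relation.Unary.Any as Any
open import Data.List.Relation.Unary.Any.Properties using (any⁺; any⁻)
open import Data.List.Relation.Unary.Unique.Propositional using (Unique)
import Data.List.Relation.Unary.Unique.Propositional.Properties as UniqueP
open import Data.Nat using (zero; suc; _+_; _⊔_; z≤n; s≤s; _≡ᵇ_; _≤ᵇ_)
open import Data.Nat.ListAction using (sum)
open import Data.Nat.ListAction.Properties using (sum-++)
open import Data.Nat.Properties
open import Data.Nat.Solver using (module +-*-Solver)
open import Data.Product using (_,_; proj₁; proj₂; swap)
import Data.Product.Properties as ×
open import Data.Sum using (_⊎_; inj₁; inj₂; [_,_]′)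
open import Data.Vec using (Vec; []; _∷_) renaming (lookup to _!_)
import Data.Vec.Properties as Vec
open import Data.Vec.Properties using (≡-dec)
open import Function using (_∘_; id; Equivalence)
open import Relation.Binary.PropositionalEquality
open import Relation.Nullary using (¬_; yes; no; ¬?; Dec; does)
open import Relation.Nullary.Decidable using (from-yes; _⊎-dec_; _×-dec_; _→-dec_)
open +-*-Solver using (solve; _:+_; _:*_; _:=_; con)

-- The subcubes of a given direction triple are never enumerated. For a fixed position p in Q₃,
-- sending a vertex v to the vertex at position p of the subcube through v permutes all vertices.
-- Hence eight times a sum over vertices is a sum over subcubes with a base point, and inequalities
-- that hold per subcube, but not per vertex, can be added up. Ordered triples and starting vertices
-- likewise avoid choosing representatives. The cost is constant factors: 12 per hexagon in total, 2
-- per hexagon for one order of the directions. The constants: each pair of an ordered triple and a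
-- vertex starts four traversals in Q_n, so Q_n has n(n-1)(n-2)2ⁿ · 4/12 hexagons, about n³2ⁿ/3. A
-- C₄-free subgraph has at most n³2ⁿ/20, which is a density of about 3/20 = 0.15. The claimed 0.1625
-- = 13/80 is larger by the factor 13/12, and this absorbs the difference between n³ and n(n-1)(n-2)
-- once n ≥ 39. Both densities are cross-multiplied, so that all arithmetic stays in ℕ.

private variable
  A B C : Set
  n : ℕ

-- Counting and sums over lists

Unique-⊆⇒length≤ : {xs ys : List A} → Unique xs → xs ⊆ ys → length xs ≤ length ys
Unique-⊆⇒length≤ [] _ = z≤n
Unique-⊆⇒length≤ {xs = x ∷ xs} {ys} (x∉ ∷ u) s with ∈-∃++ (s (here refl))
... | ys₁ , ys₂ , refl = ≤-trans (s≤s (Unique-⊆⇒length≤ u sub))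
        (≤-reflexive (trans (cong suc (length-++ ys₁))
                     (trans (sym (+-suc (length ys₁) (length ys₂))) (sym (length-++ ys₁)))))
  where
  sub : xs ⊆ ys₁ ++ ys₂
  sub z∈ with ∈-++⁻ ys₁ (s (there z∈))
  ... | inj₁ p = ∈-++⁺ˡ p
  ... | inj₂ (here refl) = ⊥-elim (All.lookup x∉ z∈ refl)
  ... | inj₂ (there p) = ∈-++⁺ʳ ys₁ p

Unique-⊆⊇⇒length≡ : {xs ys : List A} → Unique xs → Unique ys → xs ⊆ ys → ys ⊆ xs →
                    length xs ≡ length ys
Unique-⊆⊇⇒length≡ u v p q = ≤-antisym (Unique-⊆⇒length≤ u p) (Unique-⊆⇒length≤ v q)

𝟙 : Bool → ℕ
𝟙 true  = 1
𝟙 false = 0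

∑ : List A → (A → ℕ) → ℕ
∑ xs f = sum (map f xs)

syntax ∑ xs (λ x → e) = ∑[ x ∈ xs ] e

∑-cong : (xs : List A) {f g : A → ℕ} → (∀ {x} → x ∈ xs → f x ≡ g x) → ∑ xs f ≡ ∑ xs g
∑-cong []       h = refl
∑-cong (x ∷ xs) h = cong₂ _+_ (h (here refl)) (∑-cong xs (h ∘ there))

∑-mono : (xs : List A) {f g : A → ℕ} → (∀ {x} → x ∈ xs → f x ≤ g x) → ∑ xs f ≤ ∑ xs g
∑-mono []       h = z≤n
∑-mono (x ∷ xs) h = +-mono-≤ (h (here refl)) (∑-mono xs (h ∘ there))

∑-+ : (xs : List A) (f g : A → ℕ) → ∑[ x ∈ xs ] (f x + g x) ≡ ∑ xs f + ∑ xs g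
∑-+ []       f g = refl
∑-+ (x ∷ xs) f g = begin
  f x + g x + ∑[ y ∈ xs ] (f y + g y) ≡⟨ cong (f x + g x +_) (∑-+ xs f g) ⟩
  f x + g x + (∑ xs f + ∑ xs g)       ≡⟨ interchange (f x) (g x) _ _ ⟩
  f x + ∑ xs f + (g x + ∑ xs g)       ∎
  where open ≡-Reasoning
        open import Algebra.Properties.CommutativeSemigroup +-commutativeSemigroup using (interchange)

∑-*ˡ : (xs : List A) (c : ℕ) (f : A → ℕ) → ∑[ x ∈ xs ] (c * f x) ≡ c * ∑ xs f
∑-*ˡ []       c f = sym (*-zeroʳ c)
∑-*ˡ (x ∷ xs) c f = trans (cong (c * f x +_) (∑-*ˡ xs c f)) (sym (*-distribˡ-+ c (f x) (∑ xs f)))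

∑-*ʳ : (xs : List A) (c : ℕ) (f : A → ℕ) → ∑[ x ∈ xs ] (f x * c) ≡ ∑ xs f * c
∑-*ʳ xs c f = trans (∑-cong xs λ {x} _ → *-comm (f x) c) (trans (∑-*ˡ xs c f) (*-comm c _))

∑-const : (xs : List A) (c : ℕ) → ∑[ x ∈ xs ] c ≡ length xs * c
∑-const []       c = refl
∑-const (x ∷ xs) c = cong (c +_) (∑-const xs c)

∑-swap : (xs : List A) (ys : List B) (f : A → B → ℕ) →
         ∑[ x ∈ xs ] ∑[ y ∈ ys ] f x y ≡ ∑[ y ∈ ys ] ∑[ x ∈ xs ] f x y
∑-swap []       ys f = sym (trans (∑-const ys 0) (*-zeroʳ (length ys)))
∑-swap (x ∷ xs) ys f = trans (cong (∑ ys (f x) +_) (∑-swap xs ys f))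
                             (sym (∑-+ ys (f x) (λ y → ∑[ x ∈ xs ] f x y)))

∑-++ : (xs ys : List A) (f : A → ℕ) → ∑ (xs ++ ys) f ≡ ∑ xs f + ∑ ys f
∑-++ xs ys f = trans (cong sum (map-++ f xs ys)) (sum-++ (map f xs) (map f ys))

∑-map : (h : A → B) (xs : List A) (f : B → ℕ) → ∑ (map h xs) f ≡ ∑ xs (f ∘ h)
∑-map h xs f = cong sum (sym (map-∘ xs))

∑-cartesianProduct : (xs : List A) (ys : List B) (f : A × B → ℕ) →
  ∑ (cartesianProduct xs ys) f ≡ ∑[ x ∈ xs ] ∑[ y ∈ ys ] f (x , y)
∑-cartesianProduct []       ys f = refl
∑-cartesianProduct (x ∷ xs) ys f =
  trans (∑-++ (map (x ,_) ys) _ f) (cong₂ _+_ (∑-map (x ,_) ys f) (∑-cartesianProduct xs ys f))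

∑-filterᵇ-≤ : (p : A → Bool) (xs : List A) (f : A → ℕ) → ∑ (filterᵇ p xs) f ≤ ∑ xs f
∑-filterᵇ-≤ p []       f = z≤n
∑-filterᵇ-≤ p (x ∷ xs) f with p x
... | true  = +-monoʳ-≤ (f x) (∑-filterᵇ-≤ p xs f)
... | false = ≤-trans (∑-filterᵇ-≤ p xs f) (m≤n+m _ (f x))

length-filterᵇ-∑ : (p : A → Bool) (xs : List A) → length (filterᵇ p xs) ≡ ∑[ x ∈ xs ] 𝟙 (p x)
length-filterᵇ-∑ p []       = refl
length-filterᵇ-∑ p (x ∷ xs) with p x
... | true  = cong suc (length-filterᵇ-∑ p xs)
... | false = length-filterᵇ-∑ p xs

double-count : (R : A → B → Bool) (xs : List A) (ys : List B) →
  ∑[ x ∈ xs ] length (filterᵇ (R x) ys) ≡ ∑[ y ∈ ys ] length (filterᵇ (λ x → R x y) xs)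
double-count R xs ys = begin
  ∑[ x ∈ xs ] length (filterᵇ (R x) ys)            ≡⟨ ∑-cong xs (λ {x} _ → length-filterᵇ-∑ (R x) ys) ⟩
  ∑[ x ∈ xs ] ∑[ y ∈ ys ] 𝟙 (R x y)                ≡⟨ ∑-swap xs ys _ ⟩
  ∑[ y ∈ ys ] ∑[ x ∈ xs ] 𝟙 (R x y)                ≡⟨ ∑-cong ys (λ {y} _ → sym (length-filterᵇ-∑ (λ x → R x y) xs)) ⟩
  ∑[ y ∈ ys ] length (filterᵇ (λ x → R x y) xs)    ∎
  where open ≡-Reasoning

-- Sublists

∈-sublists⇒⊆ : {F G : List A} → F ∈ sublists G → F ⊆ G
∈-sublists⇒⊆ {G = []}    (here refl) ()
∈-sublists⇒⊆ {G = x ∷ G} F∈ e∈ with ∈-++⁻ (sublists G) F∈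
... | inj₁ p = there (∈-sublists⇒⊆ p e∈)
... | inj₂ p with ∈-map⁻ (x ∷_) p
... | F′ , q , refl with e∈
... | here refl = here refl
... | there r   = there (∈-sublists⇒⊆ q r)

Unique-sublists : {G : List A} → Unique G → Unique (sublists G)
Unique-sublists []       = [] ∷ []
Unique-sublists {G = x ∷ G} (x∉ ∷ u) =
  UniqueP.++⁺ (Unique-sublists u) (UniqueP.map⁺ ∷-injectiveʳ (Unique-sublists u)) disjoint
  where
  disjoint : ∀ {F} → ¬ (F ∈ sublists G × F ∈ map (x ∷_) (sublists G))
  disjoint (p , q) with ∈-map⁻ (x ∷_) q
  ... | _ , _ , refl = All.lookup x∉ (∈-sublists⇒⊆ p (here refl)) refl

Unique-∈-sublists : {F G : List A} → Unique G → F ∈ sublists G → Unique F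
Unique-∈-sublists []       (here refl) = []
Unique-∈-sublists {G = x ∷ G} (x∉ ∷ u) F∈ with ∈-++⁻ (sublists G) F∈
... | inj₁ p = Unique-∈-sublists u p
... | inj₂ p with ∈-map⁻ (x ∷_) p
... | F′ , q , refl = All.tabulate (λ e∈ → All.lookup x∉ (∈-sublists⇒⊆ q e∈)) ∷ Unique-∈-sublists u q

filterᵇ∈sublists : (p : A → Bool) (G : List A) → filterᵇ p G ∈ sublists G
filterᵇ∈sublists p []      = here refl
filterᵇ∈sublists p (x ∷ G) with p x
... | true  = ∈-++⁺ʳ (sublists G) (∈-map⁺ (x ∷_) (filterᵇ∈sublists p G))
... | false = ∈-++⁺ˡ (filterᵇ∈sublists p G)

-- Sublists keep the order of `G`, so without repetitions in `G` the set of entries fixes the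
-- sublist. This is what lets a copy, formally a list of edges, be treated as a set.
sublists-extensional : {G F₁ F₂ : List A} → Unique G → F₁ ∈ sublists G → F₂ ∈ sublists G →
                       F₁ ⊆ F₂ → F₂ ⊆ F₁ → F₁ ≡ F₂
sublists-extensional {G = []} u (here refl) (here refl) _ _ = refl
sublists-extensional {G = x ∷ G} (x∉ ∷ u) p q s t
  with ∈-++⁻ (sublists G) p | ∈-++⁻ (sublists G) q
... | inj₁ p′ | inj₁ q′ = sublists-extensional u p′ q′ s t
... | inj₁ p′ | inj₂ q′ with ∈-map⁻ (x ∷_) q′
...   | _ , _ , refl = ⊥-elim (All.lookup x∉ (∈-sublists⇒⊆ p′ (t (here refl))) refl)
sublists-extensional {G = x ∷ G} (x∉ ∷ u) p q s t | inj₂ p′ | inj₁ q′ with ∈-map⁻ (x ∷_) p′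
...   | _ , _ , refl = ⊥-elim (All.lookup x∉ (∈-sublists⇒⊆ q′ (s (here refl))) refl)
sublists-extensional {G = x ∷ G} (x∉ ∷ u) p q s t | inj₂ p′ | inj₂ q′
  with ∈-map⁻ (x ∷_) p′ | ∈-map⁻ (x ∷_) q′
...   | H₁ , a , refl | H₂ , b , refl = cong (x ∷_) (sublists-extensional u a b (tail a s) (tail b t))
  where
  tail : ∀ {H₁ H₂} → H₁ ∈ sublists G → x ∷ H₁ ⊆ x ∷ H₂ → H₁ ⊆ H₂
  tail a s e∈ with s (there e∈)
  ... | here refl = ⊥-elim (All.lookup x∉ (∈-sublists⇒⊆ a e∈) refl)
  ... | there r   = r

-- Edges and closed walks in edge lists

-- An edge is stored in one orientation, while a walk may cross it in either.
_~_ : A × A → A × A → Set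
e ~ p = e ≡ p ⊎ e ≡ swap p

_≁_ : A × A → A × A → Set
p ≁ q = ¬ (p ~ q)

Joins : List (Edge n) → Vertex n × Vertex n → Set
Joins F p = ∃[ e ] e ∈ F × e ~ p

does⁻ : {P : Set} (p? : Dec P) → T (does p?) → P
does⁻ (yes p) _ = p

does⁺ : {P : Set} (p? : Dec P) → P → T (does p?)
does⁺ (yes _) _ = _
does⁺ (no ¬p) p = ¬p p

==⇒≡ : {u v : Vertex n} → T (u == v) → u ≡ v
==⇒≡ {u = u} {v} = does⁻ (≡-dec B._≟_ u v)

≡⇒== : {u v : Vertex n} → u ≡ v → T (u == v)
≡⇒== {u = u} {v} = does⁺ (≡-dec B._≟_ u v)

matchesᵇ : Edge n → Edge n → Bool
matchesᵇ p e = ((proj₁ e == proj₁ p) ∧ (proj₂ e == proj₂ p)) ∨ ((proj₁ e == proj₂ p) ∧ (proj₂ e == proj₁ p))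

matchesᵇ⁺ : (e p : Edge n) → e ~ p → T (matchesᵇ p e)
matchesᵇ⁺ e p (inj₁ refl) = Equivalence.from T-∨ (inj₁ (Equivalence.from T-∧
  (≡⇒== {u = proj₁ e} refl , ≡⇒== {u = proj₂ e} refl)))
matchesᵇ⁺ e p (inj₂ refl) = Equivalence.from (T-∨ {(proj₁ e == proj₁ p) ∧ (proj₂ e == proj₂ p)})
  (inj₂ (Equivalence.from T-∧ (≡⇒== {u = proj₁ e} refl , ≡⇒== {u = proj₂ e} refl)))

matchesᵇ⁻ : (e p : Edge n) → T (matchesᵇ p e) → e ~ p
matchesᵇ⁻ e p t with Equivalence.to (T-∨ {(proj₁ e == proj₁ p) ∧ (proj₂ e == proj₂ p)}) t
... | inj₁ q = let r , s = Equivalence.to (T-∧ {proj₁ e == proj₁ p}) q in inj₁ (cong₂ _,_ (==⇒≡ r) (==⇒≡ s))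
... | inj₂ q = let r , s = Equivalence.to (T-∧ {proj₁ e == proj₂ p}) q in inj₂ (cong₂ _,_ (==⇒≡ r) (==⇒≡ s))

hasEdge⁺ : (F : List (Edge n)) (p : Edge n) → Joins F p → T (hasEdge F (proj₁ p) (proj₂ p))
hasEdge⁺ F p (e , e∈ , m) = any⁺ (matchesᵇ p) (lose e∈ (matchesᵇ⁺ e p m))

hasEdge⁻ : (F : List (Edge n)) (p : Edge n) → T (hasEdge F (proj₁ p) (proj₂ p)) → Joins F p
hasEdge⁻ F p t = let e , e∈ , m = find (any⁻ (matchesᵇ p) F t) in e , e∈ , matchesᵇ⁻ e p m

swap-~ : {e p : A × A} → e ~ p → e ~ swap p
swap-~ (inj₁ refl) = inj₂ refl
swap-~ (inj₂ refl) = inj₁ refl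

Joins-swap : {F : List (Edge n)} {p : Edge n} → Joins F p → Joins F (swap p)
Joins-swap (e , e∈ , m) = e , e∈ , swap-~ m

Joins-mono : {F G : List (Edge n)} {p : Edge n} → F ⊆ G → Joins F p → Joins G p
Joins-mono s (e , e∈ , m) = e , s e∈ , m

T-⇔⇒≡ : {b c : Bool} → (T b → T c) → (T c → T b) → b ≡ c
T-⇔⇒≡ {false} {false} f g = refl
T-⇔⇒≡ {false} {true}  f g = ⊥-elim (g _)
T-⇔⇒≡ {true}  {false} f g = ⊥-elim (f _)
T-⇔⇒≡ {true}  {true}  f g = refl

hasEdge-sym : (F : List (Edge n)) (u v : Vertex n) → hasEdge F u v ≡ hasEdge F v u
hasEdge-sym F u v = T-⇔⇒≡ (hasEdge⁺ F (v , u) ∘ Joins-swap ∘ hasEdge⁻ F (u , v))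
                          (hasEdge⁺ F (u , v) ∘ Joins-swap ∘ hasEdge⁻ F (v , u))

onᵇ : List (Edge n) → List (Vertex n) → Bool
onᵇ F w = all (λ p → hasEdge F (proj₁ p) (proj₂ p)) (cyclicPairs w)

_On_ : List (Vertex n) → List (Edge n) → Set
w On F = All (Joins F) (cyclicPairs w)

onᵇ⁺ : (F : List (Edge n)) (w : List (Vertex n)) → w On F → T (onᵇ F w)
onᵇ⁺ F w o = AllP.all⁻ (λ p → hasEdge F (proj₁ p) (proj₂ p)) (All.map (hasEdge⁺ F _) o)

onᵇ⁻ : (F : List (Edge n)) (w : List (Vertex n)) → T (onᵇ F w) → w On F
onᵇ⁻ F w t = All.map (hasEdge⁻ F _) (AllP.all⁺ (λ p → hasEdge F (proj₁ p) (proj₂ p)) (cyclicPairs w) t)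

not-any⁺ : {x : Vertex n} {xs : List (Vertex n)} → All (x ≢_) xs → T (not (any (x ==_) xs))
not-any⁺ {x = x} {xs} h with any (x ==_) xs in eq
... | false = _
... | true  = let y , y∈ , t = find (any⁻ (x ==_) xs (subst T (sym eq) _))
              in ⊥-elim (All.lookup h y∈ (==⇒≡ t))

not-any⁻ : {x : Vertex n} {xs : List (Vertex n)} → T (not (any (x ==_) xs)) → All (x ≢_) xs
not-any⁻ {x = x} {xs} h with any (x ==_) xs in eq
... | false = All.tabulate λ y∈ x≡y → subst T eq (any⁺ (x ==_) (lose y∈ (≡⇒== x≡y)))

distinct⁺ : {w : List (Vertex n)} → Unique w → T (distinct w)
distinct⁺ []       = _
distinct⁺ (x∉ ∷ u) = Equivalence.from T-∧ (not-any⁺ x∉ , distinct⁺ u)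

distinct⁻ : (w : List (Vertex n)) → T (distinct w) → Unique w
distinct⁻ []      _ = []
distinct⁻ (x ∷ w) d = let p , q = Equivalence.to T-∧ d in not-any⁻ p ∷ distinct⁻ w q

∈-tuples⁺ : {xs w : List A} → All (_∈ xs) w → w ∈ tuples (length w) xs
∈-tuples⁺ []       = here refl
∈-tuples⁺ (p ∷ ps) = ∈-concatMap⁺ _ (lose p (∈-map⁺ _ (∈-tuples⁺ ps)))

length-∈-tuples : (k : ℕ) {xs w : List A} → w ∈ tuples k xs → length w ≡ k
length-∈-tuples zero    (here refl) = refl
length-∈-tuples (suc k) {xs} w∈ with find (∈-concatMap⁻ _ {xs = xs} w∈)
... | x , _ , q with ∈-map⁻ (x ∷_) q
... | _ , r , refl = cong suc (length-∈-tuples k r)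

∈-endpoints : {F : List (Edge n)} {p : Edge n} → Joins F p → proj₁ p ∈ endpoints F
∈-endpoints {F = F} (e , e∈ , inj₁ refl) =
  ∈-concatMap⁺ (λ e → proj₁ e ∷ proj₂ e ∷ []) (lose e∈ (here refl))
∈-endpoints {F = F} (e , e∈ , inj₂ refl) =
  ∈-concatMap⁺ (λ e → proj₁ e ∷ proj₂ e ∷ []) (lose e∈ (there (here refl)))

isCycle⁻ : (m : ℕ) (F : List (Edge n)) → T (isCycle m F) →
           length F ≡ m × ∃[ w ] length w ≡ m × Unique w × w On F
isCycle⁻ m F t =
  let p , q = Equivalence.to (T-∧ {length F ≡ᵇ m}) t
      w , w∈ , r = find (any⁻ (λ w → distinct w ∧ onᵇ F w) (tuples m (endpoints F)) q)
      u , o = Equivalence.to (T-∧ {distinct w}) r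
  in ≡ᵇ⇒≡ _ m p , w , length-∈-tuples m w∈ , distinct⁻ w u , onᵇ⁻ F w o

-- The equation on `cyclicPairs w` says that every vertex of `w` starts a pair, which places it
-- among the endpoints of `F`. It holds by `refl` for tuples of explicit length.
isCycle⁺ : (F : List (Edge n)) (w : List (Vertex n)) → map proj₁ (cyclicPairs w) ≡ w →
           length F ≡ length w → Unique w → w On F → T (isCycle (length w) F)
isCycle⁺ F w eq l u o = Equivalence.from T-∧
  ( ≡⇒≡ᵇ (length F) (length w) l
  , any⁺ (λ w → distinct w ∧ onᵇ F w)
      (lose (∈-tuples⁺ (subst (All (_∈ endpoints F)) eq (AllP.map⁺ (All.map (∈-endpoints {F = F}) o))))
            (Equivalence.from T-∧ (distinct⁺ u , onᵇ⁺ F w o))))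

-- Copies of a cycle as sets of edges

matchingEdges : {F ps : List (Edge n)} → All (Joins F) ps → ∃[ es ] Pointwise _~_ es ps × es ⊆ F
matchingEdges [] = [] , [] , λ ()
matchingEdges ((e , e∈ , m) ∷ js) =
  let es , ms , s = matchingEdges js
  in e ∷ es , m ∷ ms , λ { (here refl) → e∈ ; (there r) → s r }

∈-Pointwiseʳ : {es ps : List (A × A)} → Pointwise _~_ es ps → ∀ {e} → e ∈ es → ∃[ p ] p ∈ ps × e ~ p
∈-Pointwiseʳ (m ∷ ms) (here refl) = _ , here refl , m
∈-Pointwiseʳ (m ∷ ms) (there e∈)  = let p , p∈ , m′ = ∈-Pointwiseʳ ms e∈ in p , there p∈ , m′

Pointwise⇒Joins : {F : List (Edge n)} {es ps : List (Edge n)} → Pointwise _~_ es ps → es ⊆ F → All (Joins F) ps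
Pointwise⇒Joins []       s = []
Pointwise⇒Joins (m ∷ ms) s = (_ , s (here refl) , m) ∷ Pointwise⇒Joins ms (s ∘ there)

~-common : {e p q : A × A} → e ~ p → e ~ q → p ~ q
~-common (inj₁ refl) m           = m
~-common (inj₂ refl) (inj₁ refl) = inj₂ refl
~-common (inj₂ refl) (inj₂ refl) = inj₁ refl

Unique-matchingEdges : {es ps : List (A × A)} → AllPairs _≁_ ps → Pointwise _~_ es ps → Unique es
Unique-matchingEdges []       []       = []
Unique-matchingEdges (d ∷ ds) (m ∷ ms) =
  All.tabulate (λ e∈ e≡ → let q , q∈ , m′ = ∈-Pointwiseʳ ms e∈
                          in All.lookup d q∈ (~-common m (subst (_~ q) (sym e≡) m′)))
  ∷ Unique-matchingEdges ds ms

_≟ᵉ_ : (e f : Edge n) → Dec (e ≡ f)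
_≟ᵉ_ = ×.≡-dec (≡-dec B._≟_) (≡-dec B._≟_)

-- An entry of `F` outside `es` could be put in front of `es`, giving a list without repetitions
-- inside `F` that is longer than `F`.
⊆-of-length : {es F : List (Edge n)} → Unique es → es ⊆ F → length F ≡ length es → F ⊆ es
⊆-of-length {es = es} {F} u s l {x} x∈ with member? _≟ᵉ_ x es
... | yes p = p
... | no ¬p = ⊥-elim (<-irrefl (sym l) (Unique-⊆⇒length≤ {xs = x ∷ es}
                (All.tabulate (λ y∈ x≡y → ¬p (subst (_∈ es) (sym x≡y) y∈)) ∷ u)
                λ { (here refl) → x∈ ; (there q) → s q }))

-- The edges matching `w` come in the order of the walk. Filtering `G` by membership among them
-- restores the order of `G`, as a sublist requires.
cycle-subgraph : {G : List (Edge n)} → Unique G → (w : List (Vertex n)) →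
  map proj₁ (cyclicPairs w) ≡ w → AllPairs _≁_ (cyclicPairs w) → Unique w → w On G →
  ∃[ F ] F ∈ sublists G × T (isCycle (length w) F) × w On F
cycle-subgraph {G = G} uG w eq d u o =
  let es , ms , s = matchingEdges o
      ue = Unique-matchingEdges d ms
      ∈es? = λ e → member? _≟ᵉ_ e es
      F = filterᵇ (does ∘ ∈es?) G
      es⊆F : es ⊆ F
      es⊆F = λ {e} e∈ → ∈-filter⁺ (T? ∘ does ∘ ∈es?) (s e∈) (does⁺ (∈es? e) e∈)
      F⊆es : F ⊆ es
      F⊆es = λ {e} e∈ → does⁻ (∈es? e) (proj₂ (∈-filter⁻ (T? ∘ does ∘ ∈es?) {xs = G} e∈))
      oF = Pointwise⇒Joins ms es⊆F
      lF = begin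
        length F                            ≡⟨ Unique-⊆⊇⇒length≡ (UniqueP.filter⁺ (T? ∘ does ∘ ∈es?) uG) ue F⊆es es⊆F ⟩
        length es                           ≡⟨ Pointwise-length ms ⟩
        length (cyclicPairs w)              ≡⟨ length-map proj₁ (cyclicPairs w) ⟨
        length (map proj₁ (cyclicPairs w))  ≡⟨ cong length eq ⟩
        length w                            ∎
  in F , filterᵇ∈sublists _ G , isCycle⁺ F w eq lF u oF , oF
  where open ≡-Reasoning

-- If both orientations of an edge were listed, one closed walk could be realised by several edge
-- lists and the copies would be counted too often.
Oriented : List (Edge n) → Set
Oriented G = ∀ {e} → e ∈ G → swap e ∉ G

~-oriented : {G : List (Edge n)} → Oriented G → {e f p : Edge n} → e ∈ G → f ∈ G → e ~ p → f ~ p → e ≡ f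
~-oriented or e∈ f∈ (inj₁ refl) (inj₁ refl) = refl
~-oriented or e∈ f∈ (inj₁ refl) (inj₂ refl) = ⊥-elim (or e∈ f∈)
~-oriented or e∈ f∈ (inj₂ refl) (inj₁ refl) = ⊥-elim (or f∈ e∈)
~-oriented or e∈ f∈ (inj₂ refl) (inj₂ refl) = refl

matchingEdges-unique : {G es fs ps : List (Edge n)} → Oriented G → es ⊆ G → fs ⊆ G →
  Pointwise _~_ es ps → Pointwise _~_ fs ps → es ≡ fs
matchingEdges-unique or s t []       []         = refl
matchingEdges-unique or s t (m ∷ ms) (m′ ∷ ms′) =
  cong₂ _∷_ (~-oriented or (s (here refl)) (t (here refl)) m m′)
            (matchingEdges-unique or (s ∘ there) (t ∘ there) ms ms′)

-- By orientation each pair of the walk is matched by a single edge of `G`. So both subgraphs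
-- contain the same matching edges, and by their length they contain nothing else.
cycle-subgraph-unique : {G F₁ F₂ : List (Edge n)} → Unique G → Oriented G →
  (ps : List (Edge n)) → AllPairs _≁_ ps → F₁ ∈ sublists G → F₂ ∈ sublists G →
  length F₁ ≡ length ps → length F₂ ≡ length ps → All (Joins F₁) ps → All (Joins F₂) ps → F₁ ≡ F₂
cycle-subgraph-unique uG or ps d p₁ p₂ l₁ l₂ o₁ o₂ with matchingEdges o₁ | matchingEdges o₂
... | es , ms , s | fs , ms′ , s′
  with matchingEdges-unique or (∈-sublists⇒⊆ p₁ ∘ s) (∈-sublists⇒⊆ p₂ ∘ s′) ms ms′
... | refl = sublists-extensional uG p₁ p₂
    (s′ ∘ ⊆-of-length ue s  (trans l₁ (sym (Pointwise-length ms))))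
    (s  ∘ ⊆-of-length ue s′ (trans l₂ (sym (Pointwise-length ms))))
  where ue = Unique-matchingEdges d ms

-- A tuple w of distinct vertices is the image of 0, …, m-1 under an injection,
-- so that statements about the shape of a cycle can be decided on Fin m.

lookup-injective : {w : List A} → Unique w → ∀ {i j} → lookup w i ≡ lookup w j → i ≡ j
lookup-injective (x∉ ∷ u) {zero}  {zero}  eq = refl
lookup-injective (x∉ ∷ u) {zero}  {suc j} eq = ⊥-elim (All.lookup x∉ (∈-lookup j) eq)
lookup-injective (x∉ ∷ u) {suc i} {zero}  eq = ⊥-elim (All.lookup x∉ (∈-lookup i) (sym eq))
lookup-injective (x∉ ∷ u) {suc i} {suc j} eq = cong suc (lookup-injective u eq)

both : (A → B) → A × A → B × B
both f (x , y) = f x , f y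

both-~⁻ : {f : A → B} → (∀ {x y} → f x ≡ f y → x ≡ y) → {p q : A × A} → both f p ~ both f q → p ~ q
both-~⁻ inj (inj₁ eq) = inj₁ (cong₂ _,_ (inj (×.,-injectiveˡ eq)) (inj (×.,-injectiveʳ eq)))
both-~⁻ inj (inj₂ eq) = inj₂ (cong₂ _,_ (inj (×.,-injectiveˡ eq)) (inj (×.,-injectiveʳ eq)))

_~?_ : {m : ℕ} (p q : Fin m × Fin m) → Dec (p ~ q)
p ~? q = ×.≡-dec Fin._≟_ Fin._≟_ p q ⊎-dec ×.≡-dec Fin._≟_ Fin._≟_ p (swap q)

map-both-≁ : {f : A → B} → (∀ {x y} → f x ≡ f y → x ≡ y) → {ps : List (A × A)} →
             AllPairs _≁_ ps → AllPairs _≁_ (map (both f) ps)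
map-both-≁ inj d = AllPairsP.map⁺ (AllPairs.map (λ ≁ → ≁ ∘ both-~⁻ inj) d)

square-pairs : {a b c d : A} → Unique (a ∷ b ∷ c ∷ d ∷ []) → AllPairs _≁_ (cyclicPairs (a ∷ b ∷ c ∷ d ∷ []))
square-pairs u = map-both-≁ (lookup-injective u)
  (from-yes (allPairs? (λ p q → ¬? (p ~? q)) (cyclicPairs (allFin 4))))

hexagon-pairs : {w : List A} → length w ≡ 6 → Unique w → AllPairs _≁_ (cyclicPairs w)
hexagon-pairs {w = _ ∷ _ ∷ _ ∷ _ ∷ _ ∷ _ ∷ []} refl u = map-both-≁ (lookup-injective u)
  (from-yes (allPairs? (λ p q → ¬? (p ~? q)) (cyclicPairs (allFin 6))))

-- Traversals of a hexagon

hexagonEdges : List (Fin 6 × Fin 6)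
hexagonEdges = cyclicPairs (allFin 6)

Adj : Fin 6 × Fin 6 → Set
Adj p = Any (p ~_) hexagonEdges

adj? : ∀ p → Dec (Adj p)
adj? p = Any.any? (p ~?_) hexagonEdges

rotations : List A → List (List A)
rotations xs = map (λ k → drop k xs ++ take k xs) (upTo (length xs))

dihedral : List (List (Fin 6))
dihedral = rotations (allFin 6) ++ rotations (reverse (allFin 6))

Unique-dihedral : Unique dihedral
Unique-dihedral = from-yes (allPairs? (λ v w → ¬? (List.≡-dec Fin._≟_ v w)) dihedral)

dihedral-adj : All (λ w → All Adj (cyclicPairs w)) dihedral
dihedral-adj = from-yes (All.all? (λ w → All.all? adj? (cyclicPairs w)) dihedral)

dihedral-unique : All Unique dihedral
dihedral-unique = from-yes (All.all? (allPairs? (λ i j → ¬? (i Fin.≟ j))) dihedral)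

-- The walks around the hexagon that never turn back immediately. The hypotheses are interleaved
-- with the quantifiers so that the decision procedure drops a branch at its first bad step.
Complete : List (List (Fin 6)) → Set
Complete D = ∀ a b → Adj (a , b) → ∀ c → Adj (b , c) → a ≢ c → ∀ d → Adj (c , d) → b ≢ d →
  ∀ e → Adj (d , e) → c ≢ e → ∀ f → Adj (e , f) → d ≢ f → a ∷ b ∷ c ∷ d ∷ e ∷ f ∷ [] ∈ D

dihedral-complete : Complete dihedral
dihedral-complete = from-yes
  (Fin.all? λ a → Fin.all? λ b → adj? (a , b) →-dec (Fin.all? λ c → adj? (b , c) →-dec (¬? (a Fin.≟ c) →-dec
  (Fin.all? λ d → adj? (c , d) →-dec (¬? (b Fin.≟ d) →-dec (Fin.all? λ e → adj? (d , e) →-dec (¬? (c Fin.≟ e) →-dec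
  (Fin.all? λ f → adj? (e , f) →-dec (¬? (d Fin.≟ f) →-dec
    member? (List.≡-dec Fin._≟_) (a ∷ b ∷ c ∷ d ∷ e ∷ f ∷ []) dihedral)))))))))

dihedral-pairs : (φ : Fin 6 → A) →
  All (λ w → cyclicPairs (map φ w) ≡ map (both φ) (cyclicPairs w)) dihedral
dihedral-pairs φ = refl ∷ refl ∷ refl ∷ refl ∷ refl ∷ refl ∷ refl ∷ refl ∷ refl ∷ refl ∷ refl ∷ refl ∷ []

IsHexagonIn : List (Edge n) → List (Vertex n) → Set
IsHexagonIn F w = length w ≡ 6 × Unique w × w On F

-- Distinct vertices two places apart mean that the walk never turns back. Its vertices are
-- translated into indices one at a time: `index` handles the first edge, `next` each later step.
trace : (φ : Fin 6 → A) (J : A × A → Set) →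
  (∀ r {v} → J (φ r , v) → ∃[ s ] v ≡ φ s × Adj (r , s)) →
  (∀ {p} → J p → ∃[ r ] ∃[ s ] p ≡ (φ r , φ s) × Adj (r , s)) →
  (D : List (List (Fin 6))) →
  Complete D →
  ∀ {v} → length v ≡ 6 × Unique v × All J (cyclicPairs v) → v ∈ map (map φ) D
trace φ J next index D complete {a ∷ b ∷ c ∷ d ∷ e ∷ f ∷ []}
  (refl , (_ ∷ a≢c ∷ _) ∷ (_ ∷ b≢d ∷ _) ∷ (_ ∷ c≢e ∷ _) ∷ (_ ∷ d≢f ∷ _) ∷ _ , ab ∷ bc ∷ cd ∷ de ∷ ef ∷ _)
  with index ab
... | r₀ , r₁ , refl , adj₀ with next r₁ bc
... | r₂ , refl , adj₁ with next r₂ cd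
... | r₃ , refl , adj₂ with next r₃ de
... | r₄ , refl , adj₃ with next r₄ ef
... | r₅ , refl , adj₄ = ∈-map⁺ (map φ) (complete r₀ r₁ adj₀ r₂ adj₁ (a≢c ∘ cong φ)
                           r₃ adj₂ (b≢d ∘ cong φ) r₄ adj₃ (c≢e ∘ cong φ) r₅ adj₄ (d≢f ∘ cong φ))

-- The six edges of `w` already exhaust `F`, so every pair joined in `F` is a pair of neighbours on
-- `w`, and any 6-cycle in `F` runs around `w`: six starting points and two orientations.
hexagon-traversals : {F : List (Edge n)} → length F ≡ 6 → {w : List (Vertex n)} → IsHexagonIn F w →
  (ws : List (List (Vertex n))) → Unique ws → (∀ {v} → v ∈ ws → IsHexagonIn F v) →
  (∀ {v} → IsHexagonIn F v → v ∈ ws) → length ws ≡ 12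
hexagon-traversals {n} {F} lF {w@(_ ∷ _ ∷ _ ∷ _ ∷ _ ∷ _ ∷ [])} (refl , uw , on) ws uws sound complete =
  Unique-⊆⊇⇒length≡ uws (UniqueP.map⁺ (List.map-injective φ-inj) Unique-dihedral) (⊇ ∘ sound) (complete ∘ ⊆)
  where
  φ : Fin 6 → Vertex n
  φ = lookup w

  φ-inj : ∀ {i j} → φ i ≡ φ j → i ≡ j
  φ-inj = lookup-injective uw

  index : ∀ {p} → Joins F p → ∃[ r ] ∃[ s ] p ≡ (φ r , φ s) × Adj (r , s)
  index (e , e∈ , m) =
    let es , ms , s = matchingEdges on
        ue = Unique-matchingEdges (hexagon-pairs refl uw) ms
        q , q∈ , m′ = ∈-Pointwiseʳ ms (⊆-of-length ue s (trans lF (sym (Pointwise-length ms))) e∈)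
        (r , t) , rt∈ , eq = ∈-map⁻ (both φ) q∈
    in [ (λ p≡q → r , t , trans p≡q eq , lose rt∈ (inj₁ refl))
       , (λ p≡q → t , r , trans p≡q (cong swap eq) , lose rt∈ (inj₂ refl)) ]′ (~-common m m′)

  next : ∀ r {v} → Joins F (φ r , v) → ∃[ s ] v ≡ φ s × Adj (r , s)
  next r j =
    let r′ , s , eq , adj = index j
    in s , ×.,-injectiveʳ eq , subst (λ r → Adj (r , s)) (φ-inj (sym (×.,-injectiveˡ eq))) adj

  joins : ∀ {p} → Adj p → Joins F (both φ p)
  joins {p} a with find a
  ... | q , q∈ , m = move m (All.lookup on (∈-map⁺ (both φ) q∈))
    where
    move : p ~ q → Joins F (both φ q) → Joins F (both φ p)
    move (inj₁ refl) j = j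
    move (inj₂ refl) j = Joins-swap j

  ⊆ : ∀ {v} → v ∈ map (map φ) dihedral → IsHexagonIn F v
  ⊆ v∈ with ∈-map⁻ (map φ) v∈
  ... | π , π∈ , refl =
      All.lookup dihedral-length π∈
    , UniqueP.map⁺ φ-inj (All.lookup dihedral-unique π∈)
    , subst (All (Joins F)) (sym (All.lookup (dihedral-pairs φ) π∈))
        (AllP.map⁺ (All.map joins (All.lookup dihedral-adj π∈)))
    where
    dihedral-length : All (λ π → length (map φ π) ≡ 6) dihedral
    dihedral-length = refl ∷ refl ∷ refl ∷ refl ∷ refl ∷ refl ∷ refl ∷ refl ∷ refl ∷ refl ∷ refl ∷ refl ∷ []

  ⊇ : ∀ {v} → IsHexagonIn F v → v ∈ map (map φ) dihedral
  ⊇ = trace φ (Joins F) next index dihedral dihedral-complete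

-- The hypercube

flip-involutive : (i : Fin n) (v : Vertex n) → flipAt i (flipAt i v) ≡ v
flip-involutive i v = trans (Vec.updateAt-updateAt-local i v (not-involutive (v ! i))) (Vec.updateAt-id i v)

flip-comm : (i j : Fin n) (v : Vertex n) → flipAt i (flipAt j v) ≡ flipAt j (flipAt i v)
flip-comm i j v with i Fin.≟ j
... | yes refl = refl
... | no i≢j   = Vec.updateAt-commutes i j i≢j v

!-flip : (i x : Fin n) (v : Vertex n) → flipAt i v ! x ≡ does (i Fin.≟ x) xor (v ! x)
!-flip i x v with i Fin.≟ x
... | yes refl = Vec.lookup∘updateAt i v
... | no i≢x   = Vec.lookup∘updateAt′ x i (i≢x ∘ sym) v

!-flip-same : (i : Fin n) (v : Vertex n) → flipAt i v ! i ≡ not (v ! i)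
!-flip-same i v = Vec.lookup∘updateAt i v

!-flip-other : {i x : Fin n} → i ≢ x → (v : Vertex n) → flipAt i v ! x ≡ v ! x
!-flip-other {i = i} {x} i≢x v = Vec.lookup∘updateAt′ x i (i≢x ∘ sym) v

flip-injective : {i j : Fin n} (v : Vertex n) → flipAt i v ≡ flipAt j v → i ≡ j
flip-injective {i = i} {j} v eq with i Fin.≟ j
... | yes i≡j = i≡j
... | no  i≢j = ⊥-elim (not-¬ refl (trans (sym (!-flip-other (i≢j ∘ sym) v))
                  (trans (cong (_! i) (sym eq)) (!-flip-same i v))))

Unique-concatMap : (f : A → List B) {xs : List A} → Unique xs → (∀ x → Unique (f x)) →
                   (∀ {x y z} → z ∈ f x → z ∈ f y → x ≡ y) → Unique (concatMap f xs)
Unique-concatMap f []               uf disj = []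
Unique-concatMap f {xs = x ∷ xs} (x∉ ∷ u) uf disj =
  UniqueP.++⁺ (uf x) (Unique-concatMap f u uf disj)
    λ (p , q) → let y , y∈ , r = find (∈-concatMap⁻ f {xs = xs} q) in All.lookup x∉ y∈ (disj p r)

Unique-allVertices : (n : ℕ) → Unique (allVertices n)
Unique-allVertices zero    = [] ∷ []
Unique-allVertices (suc n) = Unique-concatMap _ (Unique-allVertices n)
  (λ _ → ((λ ()) ∷ []) ∷ [] ∷ [])
  λ { (here refl) (here refl) → refl ; (there (here refl)) (there (here refl)) → refl
    ; (here refl) (there (here ())) ; (there (here refl)) (here ()) }

∈-allVertices : (v : Vertex n) → v ∈ allVertices n
∈-allVertices []          = here refl
∈-allVertices (false ∷ v) = ∈-concatMap⁺ _ (lose (∈-allVertices v) (here refl))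
∈-allVertices (true ∷ v)  = ∈-concatMap⁺ _ (lose (∈-allVertices v) (there (here refl)))

∑-allVertices : (n : ℕ) (f : Vertex (suc n) → ℕ) →
  ∑ (allVertices (suc n)) f ≡ ∑[ v ∈ allVertices n ] (f (false ∷ v) + f (true ∷ v))
∑-allVertices n f = go (allVertices n)
  where
  go : ∀ vs → ∑ (concatMap (λ v → (false ∷ v) ∷ (true ∷ v) ∷ []) vs) f ≡ ∑[ v ∈ vs ] (f (false ∷ v) + f (true ∷ v))
  go []       = refl
  go (v ∷ vs) = trans (cong (λ s → f (false ∷ v) + (f (true ∷ v) + s)) (go vs)) (sym (+-assoc (f (false ∷ v)) _ _))

∑-flip : (i : Fin n) (f : Vertex n → ℕ) → ∑[ v ∈ allVertices n ] f (flipAt i v) ≡ ∑ (allVertices n) f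
∑-flip {suc n} zero f = begin
  ∑[ v ∈ allVertices (suc n) ] f (flipAt zero v)           ≡⟨ ∑-allVertices n (f ∘ flipAt zero) ⟩
  ∑[ v ∈ allVertices n ] (f (true ∷ v) + f (false ∷ v))    ≡⟨ ∑-cong (allVertices n) (λ {v} _ → +-comm (f (true ∷ v)) _) ⟩
  ∑[ v ∈ allVertices n ] (f (false ∷ v) + f (true ∷ v))    ≡⟨ ∑-allVertices n f ⟨
  ∑ (allVertices (suc n)) f                                ∎
  where open ≡-Reasoning
∑-flip {suc n} (suc i) f = begin
  ∑[ v ∈ allVertices (suc n) ] f (flipAt (suc i) v)        ≡⟨ ∑-allVertices n (f ∘ flipAt (suc i)) ⟩
  ∑[ v ∈ allVertices n ] f± (flipAt i v)                   ≡⟨ ∑-flip i f± ⟩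
  ∑[ v ∈ allVertices n ] f± v                              ≡⟨ ∑-allVertices n f ⟨
  ∑ (allVertices (suc n)) f                                ∎
  where
  open ≡-Reasoning
  f± : Vertex n → ℕ
  f± v = f (false ∷ v) + f (true ∷ v)

upEdges : Vertex n → Fin n → List (Edge n)
upEdges u i = if u ! i then [] else ((u , flipAt i u) ∷ [])

∈-upEdges⁻ : {u : Vertex n} {i : Fin n} {e : Edge n} → e ∈ upEdges u i → u ! i ≡ false × e ≡ (u , flipAt i u)
∈-upEdges⁻ {u = u} {i} e∈ with u ! i | e∈
... | false | here refl = refl , refl

∈-upEdges⁺ : {u : Vertex n} {i : Fin n} → u ! i ≡ false → (u , flipAt i u) ∈ upEdges u i
∈-upEdges⁺ eq rewrite eq = here refl

∈-cubeEdges⁻ : {e : Edge n} → e ∈ cubeEdges n → ∃[ i ] proj₁ e ! i ≡ false × proj₂ e ≡ flipAt i (proj₁ e)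
∈-cubeEdges⁻ {n} e∈ with find (∈-concatMap⁻ (λ u → concatMap (upEdges u) (allFin n)) {xs = allVertices n} e∈)
... | u , _ , p with find (∈-concatMap⁻ (upEdges u) {xs = allFin n} p)
... | i , _ , q with ∈-upEdges⁻ {u = u} {i} q
... | eq , refl = i , eq , refl

∈-cubeEdges⁺ : {u : Vertex n} {i : Fin n} → u ! i ≡ false → (u , flipAt i u) ∈ cubeEdges n
∈-cubeEdges⁺ {n} {u} {i} eq = ∈-concatMap⁺ (λ u → concatMap (upEdges u) (allFin n))
  (lose (∈-allVertices u) (∈-concatMap⁺ (upEdges u) (lose (∈-allFin i) (∈-upEdges⁺ eq))))

Unique-cubeEdges : (n : ℕ) → Unique (cubeEdges n)
Unique-cubeEdges n = Unique-concatMap _ (Unique-allVertices n)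
  (λ u → Unique-concatMap (upEdges u) (UniqueP.allFin⁺ n) (unique u)
    λ {i} {j} p q → flip-injective u (×.,-injectiveʳ
      (trans (sym (proj₂ (∈-upEdges⁻ {u = u} {i} p))) (proj₂ (∈-upEdges⁻ {u = u} {j} q)))))
  λ p q → trans (sym (source p)) (source q)
  where
  unique : ∀ u i → Unique (upEdges u i)
  unique u i with u ! i
  ... | true  = []
  ... | false = [] ∷ []
  source : ∀ {u e} → e ∈ concatMap (upEdges u) (allFin n) → proj₁ e ≡ u
  source {u} p = let i , _ , q = find (∈-concatMap⁻ (upEdges u) {xs = allFin n} p)
                 in cong proj₁ (proj₂ (∈-upEdges⁻ {u = u} {i} q))

Oriented-cubeEdges : (n : ℕ) → Oriented (cubeEdges n)
Oriented-cubeEdges n {u , w} p q with ∈-cubeEdges⁻ p | ∈-cubeEdges⁻ q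
... | i , ui , refl | j , wj , eq with i Fin.≟ j
...   | yes refl with () ← trans (sym wj) (trans (!-flip-same i u) (cong not ui))
...   | no i≢j   with () ← trans (sym wj) (trans (!-flip-other i≢j u) (trans (cong (_! j) eq)
                            (trans (!-flip-same j (flipAt i u)) (cong not wj))))

Joins-cube⁺ : (u : Vertex n) (i : Fin n) → Joins (cubeEdges n) (u , flipAt i u)
Joins-cube⁺ u i with u ! i in eq
... | false = _ , ∈-cubeEdges⁺ eq , inj₁ refl
... | true  = _ , ∈-cubeEdges⁺ {u = flipAt i u} {i} (trans (!-flip-same i u) (cong not eq))
            , inj₂ (cong (flipAt i u ,_) (flip-involutive i u))

Joins-cube⁻ : {u w : Vertex n} → Joins (cubeEdges n) (u , w) → ∃[ i ] w ≡ flipAt i u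
Joins-cube⁻ {u = u} {w} (_ , e∈ , m) with ∈-cubeEdges⁻ e∈ | m
... | i , _ , eq | inj₁ refl = i , eq
... | i , _ , eq | inj₂ refl = i , trans (sym (flip-involutive i w)) (cong (flipAt i) (sym eq))

-- Hexagons lie in 3-dimensional subcubes

Triple : ℕ → Set
Triple n = Fin n × Fin n × Fin n

dir : Triple n → Fin 3 → Fin n
dir (i , j , k) d = (i ∷ j ∷ k ∷ []) ! d

Distinct : Triple n → Set
Distinct (i , j , k) = i ≢ j × i ≢ k × j ≢ k

distinct? : (τ : Triple n) → Dec (Distinct τ)
distinct? (i , j , k) = ¬? (i Fin.≟ j) ×-dec ¬? (i Fin.≟ k) ×-dec ¬? (j Fin.≟ k)

flipIf : Bool → Fin n → Vertex n → Vertex n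
flipIf b i v = if b then flipAt i v else v

-- Positions are relative to `v`: `origin` goes to `v` itself, whatever its coordinates are. For
-- fixed `p` this is a composition of flips and hence a permutation in `v`.
embed : Triple n → Vertex n → Vertex 3 → Vertex n
embed (i , j , k) v (x ∷ y ∷ z ∷ []) = flipIf x i (flipIf y j (flipIf z k v))

origin : Vertex 3
origin = false ∷ false ∷ false ∷ []

flipIf-comm : (i j : Fin n) (b : Bool) (v : Vertex n) → flipAt i (flipIf b j v) ≡ flipIf b j (flipAt i v)
flipIf-comm i j true  v = flip-comm i j v
flipIf-comm i j false v = refl

flip-flipIf : (i : Fin n) (b : Bool) (v : Vertex n) → flipAt i (flipIf b i v) ≡ flipIf (not b) i v
flip-flipIf i true  v = flip-involutive i v
flip-flipIf i false v = refl

flip-embed : (τ : Triple n) (v : Vertex n) (d : Fin 3) (p : Vertex 3) →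
             flipAt (dir τ d) (embed τ v p) ≡ embed τ v (flipAt d p)
flip-embed (i , j , k) v zero (x ∷ y ∷ z ∷ []) = flip-flipIf i x _
flip-embed (i , j , k) v (suc zero) (x ∷ y ∷ z ∷ []) =
  trans (flipIf-comm j i x _) (cong (flipIf x i) (flip-flipIf j y _))
flip-embed (i , j , k) v (suc (suc zero)) (x ∷ y ∷ z ∷ []) =
  trans (flipIf-comm k i x _) (cong (flipIf x i)
    (trans (flipIf-comm k j y _) (cong (flipIf y j) (flip-flipIf k z v))))

!-flipIf-same : (i : Fin n) (b : Bool) (v : Vertex n) → flipIf b i v ! i ≡ b xor (v ! i)
!-flipIf-same i true  v = !-flip-same i v
!-flipIf-same i false v = refl

!-flipIf-other : {i x : Fin n} → i ≢ x → (b : Bool) (v : Vertex n) → flipIf b i v ! x ≡ v ! x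
!-flipIf-other i≢x true  v = !-flip-other i≢x v
!-flipIf-other i≢x false v = refl

!-embed : {τ : Triple n} → Distinct τ → (v : Vertex n) (p : Vertex 3) (d : Fin 3) →
          embed τ v p ! dir τ d ≡ (p ! d) xor (v ! dir τ d)
!-embed {τ = i , j , k} (i≢j , i≢k , j≢k) v (x ∷ y ∷ z ∷ []) zero =
  trans (!-flipIf-same i x _) (cong (x xor_)
    (trans (!-flipIf-other (i≢j ∘ sym) y _) (!-flipIf-other (i≢k ∘ sym) z v)))
!-embed {τ = i , j , k} (i≢j , i≢k , j≢k) v (x ∷ y ∷ z ∷ []) (suc zero) =
  trans (!-flipIf-other i≢j x _) (trans (!-flipIf-same j y _) (cong (y xor_) (!-flipIf-other (j≢k ∘ sym) z v)))
!-embed {τ = i , j , k} (i≢j , i≢k , j≢k) v (x ∷ y ∷ z ∷ []) (suc (suc zero)) =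
  trans (!-flipIf-other i≢k x _) (trans (!-flipIf-other j≢k y _) (!-flipIf-same k z v))

xor-cancelʳ : {a b : Bool} (c : Bool) → a xor c ≡ b xor c → a ≡ b
xor-cancelʳ {false} {false} c eq = refl
xor-cancelʳ {true}  {true}  c eq = refl
xor-cancelʳ {false} {true}  c eq = ⊥-elim (not-¬ refl eq)
xor-cancelʳ {true}  {false} c eq = ⊥-elim (not-¬ refl (sym eq))

Vec3-ext : {p q : Vertex 3} → (∀ d → p ! d ≡ q ! d) → p ≡ q
Vec3-ext {_ ∷ _ ∷ _ ∷ []} {_ ∷ _ ∷ _ ∷ []} h =
  cong₂ _∷_ (h zero) (cong₂ _∷_ (h (suc zero)) (cong (_∷ []) (h (suc (suc zero)))))

embed-injective : {τ : Triple n} → Distinct τ → (v : Vertex n) → ∀ {p q} → embed τ v p ≡ embed τ v q → p ≡ q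
embed-injective {τ = τ} dτ v {p} {q} eq = Vec3-ext λ d → xor-cancelʳ (v ! dir τ d)
  (trans (sym (!-embed dτ v p d)) (trans (cong (_! dir τ d) eq) (!-embed dτ v q d)))

-- Closed walks described by their directions

walk : Vertex n → List (Fin n) → List (Vertex n)
walk v []       = []
walk v (d ∷ ds) = v ∷ walk (flipAt d v) ds

end : Vertex n → List (Fin n) → Vertex n
end v []       = v
end v (d ∷ ds) = end (flipAt d v) ds

-- Follows the directions to the end instead of returning to the first vertex as `onᵇ` does, so it
-- is recursive in the word. The two agree on closed walks.
pathᵇ : List (Edge n) → Vertex n → List (Fin n) → Bool
pathᵇ G v []       = true
pathᵇ G v (d ∷ ds) = hasEdge G v (flipAt d v) ∧ pathᵇ G (flipAt d v) ds

walk-embed : (τ : Triple n) (v : Vertex n) (p : Vertex 3) (ds : List (Fin 3)) →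
             walk (embed τ v p) (map (dir τ) ds) ≡ map (embed τ v) (walk p ds)
walk-embed τ v p []       = refl
walk-embed τ v p (d ∷ ds) = cong (embed τ v p ∷_)
  (trans (cong (λ u → walk u (map (dir τ) ds)) (flip-embed τ v d p)) (walk-embed τ v (flipAt d p) ds))

end-embed : (τ : Triple n) (v : Vertex n) (p : Vertex 3) (ds : List (Fin 3)) →
            end (embed τ v p) (map (dir τ) ds) ≡ embed τ v (end p ds)
end-embed τ v p []       = refl
end-embed τ v p (d ∷ ds) =
  trans (cong (λ u → end u (map (dir τ) ds)) (flip-embed τ v d p)) (end-embed τ v (flipAt d p) ds)

onᵇ-walk₄ : (G : List (Edge n)) {v : Vertex n} {a b c d : Fin n} → end v (a ∷ b ∷ c ∷ d ∷ []) ≡ v →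
            onᵇ G (walk v (a ∷ b ∷ c ∷ d ∷ [])) ≡ pathᵇ G v (a ∷ b ∷ c ∷ d ∷ [])
onᵇ-walk₄ G {v} {a} {b} {c} {d} closed =
  cong (λ u → hasEdge G v₀ v₁ ∧ hasEdge G v₁ v₂ ∧ hasEdge G v₂ v₃ ∧ hasEdge G v₃ u ∧ true) (sym closed)
  where v₀ = v ; v₁ = flipAt a v₀ ; v₂ = flipAt b v₁ ; v₃ = flipAt c v₂

onᵇ-walk₆ : (G : List (Edge n)) {v : Vertex n} {a b c d e f : Fin n} → end v (a ∷ b ∷ c ∷ d ∷ e ∷ f ∷ []) ≡ v →
            onᵇ G (walk v (a ∷ b ∷ c ∷ d ∷ e ∷ f ∷ [])) ≡ pathᵇ G v (a ∷ b ∷ c ∷ d ∷ e ∷ f ∷ [])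
onᵇ-walk₆ G {v} {a} {b} {c} {d} {e} {f} closed =
  cong (λ u → hasEdge G v₀ v₁ ∧ hasEdge G v₁ v₂ ∧ hasEdge G v₂ v₃ ∧ hasEdge G v₃ v₄ ∧ hasEdge G v₄ v₅ ∧
              hasEdge G v₅ u ∧ true) (sym closed)
  where v₀ = v ; v₁ = flipAt a v₀ ; v₂ = flipAt b v₁ ; v₃ = flipAt c v₂ ; v₄ = flipAt d v₃ ; v₅ = flipAt e v₄

-- The four direction patterns of a 6-cycle with a marked start and orientation:
-- the first is the induced one, in the others two opposite vertices are joined by a chord.
word : Fin 4 → List (Fin 3)
word zero                   = # 0 ∷ # 1 ∷ # 2 ∷ # 0 ∷ # 1 ∷ # 2 ∷ []
word (suc zero)             = # 0 ∷ # 1 ∷ # 2 ∷ # 0 ∷ # 2 ∷ # 1 ∷ []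
word (suc (suc zero))       = # 0 ∷ # 1 ∷ # 2 ∷ # 1 ∷ # 0 ∷ # 2 ∷ []
word (suc (suc (suc zero))) = # 0 ∷ # 1 ∷ # 0 ∷ # 2 ∷ # 1 ∷ # 2 ∷ []

Code : ℕ → Set
Code n = Fin 4 × Triple n × Vertex n

hexagon : Code n → List (Vertex n)
hexagon (t , τ , v) = walk v (map (dir τ) (word t))

hexagon-closed : (t : Fin 4) (τ : Triple n) (v : Vertex n) → end v (map (dir τ) (word t)) ≡ v
hexagon-closed t τ v = trans (end-embed τ v origin (word t)) (cong (embed τ v) (closed t))
  where
  closed : ∀ t → end origin (word t) ≡ origin
  closed zero                   = refl
  closed (suc zero)             = refl
  closed (suc (suc zero))       = refl
  closed (suc (suc (suc zero))) = refl

onᵇ-hexagon : (G : List (Edge n)) (t : Fin 4) (τ : Triple n) (v : Vertex n) →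
              onᵇ G (hexagon (t , τ , v)) ≡ pathᵇ G v (map (dir τ) (word t))
onᵇ-hexagon G t@zero                   τ v = onᵇ-walk₆ G (hexagon-closed t τ v)
onᵇ-hexagon G t@(suc zero)             τ v = onᵇ-walk₆ G (hexagon-closed t τ v)
onᵇ-hexagon G t@(suc (suc zero))       τ v = onᵇ-walk₆ G (hexagon-closed t τ v)
onᵇ-hexagon G t@(suc (suc (suc zero))) τ v = onᵇ-walk₆ G (hexagon-closed t τ v)

length-hexagon : (x : Code n) → length (hexagon x) ≡ 6
length-hexagon (zero , _)                   = refl
length-hexagon (suc zero , _)               = refl
length-hexagon (suc (suc zero) , _)         = refl
length-hexagon (suc (suc (suc zero)) , _)   = refl

unique-walk? : (ds : List (Fin 3)) → Dec (Unique (walk origin ds))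
unique-walk? ds = allPairs? (λ u v → ¬? (≡-dec B._≟_ u v)) (walk origin ds)

Unique-walk-embed : {τ : Triple n} → Distinct τ → (v : Vertex n) (ds : List (Fin 3)) →
                    Unique (walk origin ds) → Unique (walk v (map (dir τ) ds))
Unique-walk-embed {τ = τ} dτ v ds u =
  subst Unique (sym (walk-embed τ v origin ds)) (UniqueP.map⁺ (embed-injective dτ v) u)

Unique-hexagon : (t : Fin 4) {τ : Triple n} → Distinct τ → (v : Vertex n) → Unique (hexagon (t , τ , v))
Unique-hexagon t dτ v = Unique-walk-embed dτ v (word t) (unique t)
  where
  unique : ∀ t → Unique (walk origin (word t))
  unique zero                   = from-yes (unique-walk? (word (# 0)))
  unique (suc zero)             = from-yes (unique-walk? (word (# 1)))
  unique (suc (suc zero))       = from-yes (unique-walk? (word (# 2)))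
  unique (suc (suc (suc zero))) = from-yes (unique-walk? (word (# 3)))

-- The last direction leads to a vertex that `walk` does not list, hence only the first `m` of
-- `suc m` directions are recovered.
walk-injective : (v : Vertex n) (m : ℕ) (ds es : List (Fin n)) → length ds ≡ suc m → length es ≡ suc m →
                 walk v ds ≡ walk v es → take m ds ≡ take m es
walk-injective v zero    ds            es            _ _ eq = refl
walk-injective v (suc m) (d ∷ d′ ∷ ds) (e ∷ e′ ∷ es) p q eq
  with flip-injective v (proj₁ (∷-injective (∷-injectiveʳ eq)))
... | refl = cong (d ∷_)
    (walk-injective (flipAt d v) m (d′ ∷ ds) (e′ ∷ es) (suc-injective p) (suc-injective q) (∷-injectiveʳ eq))

hexagon-start : (x : Code n) → ∃[ w ] hexagon x ≡ proj₂ (proj₂ x) ∷ w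
hexagon-start (zero , _)                 = _ , refl
hexagon-start (suc zero , _)             = _ , refl
hexagon-start (suc (suc zero) , _)       = _ , refl
hexagon-start (suc (suc (suc zero)) , _) = _ , refl

-- The first five directions are enough. Each word shows all three directions among them, and
-- matching two different words makes two directions of a triple equal.
hexagon-injective : {x y : Code n} → Distinct (proj₁ (proj₂ x)) → Distinct (proj₁ (proj₂ y)) →
                    hexagon x ≡ hexagon y → x ≡ y
hexagon-injective {x = x@(s , (i , j , k) , u)} {y@(t , (i′ , j′ , k′) , v)} (i≢j , i≢k , j≢k) (i≢j′ , i≢k′ , j≢k′) eq
  with proj₁ (∷-injective (trans (sym (proj₂ (hexagon-start x))) (trans eq (proj₂ (hexagon-start y)))))
... | refl = cases s t (walk-injective u 5 (map (dir _) (word s)) (map (dir _) (word t))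
                         (length-word s) (length-word t) eq)
  where
  length-word : {τ : Triple n} (t : Fin 4) → length (map (dir τ) (word t)) ≡ 6
  length-word zero                   = refl
  length-word (suc zero)             = refl
  length-word (suc (suc zero))       = refl
  length-word (suc (suc (suc zero))) = refl
  cases : ∀ s t → take 5 (map (dir (i , j , k)) (word s)) ≡ take 5 (map (dir (i′ , j′ , k′)) (word t)) →
          (s , (i , j , k) , u) ≡ (t , (i′ , j′ , k′) , u)
  cases zero zero refl = refl
  cases zero (suc zero) refl = ⊥-elim (j≢k refl)
  cases zero (suc (suc zero)) refl = ⊥-elim (i≢j refl)
  cases zero (suc (suc (suc zero))) refl = ⊥-elim (i≢k refl)
  cases (suc zero) zero refl = ⊥-elim (j≢k refl)
  cases (suc zero) (suc zero) refl = refl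
  cases (suc zero) (suc (suc zero)) refl = ⊥-elim (i≢j refl)
  cases (suc zero) (suc (suc (suc zero))) refl = ⊥-elim (i≢k refl)
  cases (suc (suc zero)) zero refl = ⊥-elim (i≢j refl)
  cases (suc (suc zero)) (suc zero) refl = ⊥-elim (i≢j refl)
  cases (suc (suc zero)) (suc (suc zero)) refl = refl
  cases (suc (suc zero)) (suc (suc (suc zero))) refl = ⊥-elim (i≢k refl)
  cases (suc (suc (suc zero))) zero refl = ⊥-elim (i≢k′ refl)
  cases (suc (suc (suc zero))) (suc zero) refl = ⊥-elim (i≢k′ refl)
  cases (suc (suc (suc zero))) (suc (suc zero)) refl = ⊥-elim (i≢k′ refl)
  cases (suc (suc (suc zero))) (suc (suc (suc zero))) refl = refl

-- In a closed walk a, b, …, g every direction occurs an even number of times,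
-- so a non-backtracking one has exactly one further occurrence of a among c, e, f.
partner : {v : Vertex n} (a b c e f g : Fin n) → end v (a ∷ b ∷ c ∷ e ∷ f ∷ g ∷ []) ≡ v →
          b ≢ a → e ≢ c → f ≢ e → g ≢ a → (c ≡ a × f ≢ a) ⊎ (e ≡ a) ⊎ (f ≡ a × c ≢ a)
partner {v = v} a b c e f g closed b≢a e≢c f≢e g≢a with c Fin.≟ a | e Fin.≟ a | f Fin.≟ a | count
  where
  count : (does (f Fin.≟ a) xor (does (e Fin.≟ a) xor (does (c Fin.≟ a) xor not (v ! a)))) ≡ v ! a
  count = begin
    does (f Fin.≟ a) xor (does (e Fin.≟ a) xor (does (c Fin.≟ a) xor not (v ! a)))
      ≡⟨ cong (λ x → does (f Fin.≟ a) xor (does (e Fin.≟ a) xor (does (c Fin.≟ a) xor x))) (!-flip-same a v) ⟨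
    does (f Fin.≟ a) xor (does (e Fin.≟ a) xor (does (c Fin.≟ a) xor (v₁ ! a)))
      ≡⟨ cong (λ x → does (f Fin.≟ a) xor (does (e Fin.≟ a) xor (does (c Fin.≟ a) xor x))) (!-flip-other b≢a v₁) ⟨
    does (f Fin.≟ a) xor (does (e Fin.≟ a) xor (does (c Fin.≟ a) xor (v₂ ! a)))
      ≡⟨ cong (λ x → does (f Fin.≟ a) xor (does (e Fin.≟ a) xor x)) (!-flip c a v₂) ⟨
    does (f Fin.≟ a) xor (does (e Fin.≟ a) xor (v₃ ! a))
      ≡⟨ cong (does (f Fin.≟ a) xor_) (!-flip e a v₃) ⟨
    does (f Fin.≟ a) xor (v₄ ! a)
      ≡⟨ !-flip f a v₄ ⟨
    v₅ ! a
      ≡⟨ !-flip-other g≢a v₅ ⟨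
    flipAt g v₅ ! a
      ≡⟨ cong (_! a) closed ⟩
    v ! a ∎
    where
    open ≡-Reasoning
    v₁ = flipAt a v ; v₂ = flipAt b v₁ ; v₃ = flipAt c v₂ ; v₄ = flipAt e v₃ ; v₅ = flipAt f v₄
... | yes p | yes q | _     | _  = ⊥-elim (e≢c (trans q (sym p)))
... | _     | yes q | yes r | _  = ⊥-elim (f≢e (trans r (sym q)))
... | no _  | yes q | no _  | _  = inj₂ (inj₁ q)
... | yes p | no _  | no r  | _  = inj₁ (p , r)
... | no p  | no _  | yes r | _  = inj₂ (inj₂ (r , p))
... | yes _ | no _  | yes _ | eq = ⊥-elim (not-¬ refl (trans (sym eq) (not-involutive (not (v ! a)))))
... | no _  | no _  | no _  | eq = ⊥-elim (not-¬ refl (sym eq))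

rotate : {v : Vertex n} {d : Fin n} (ds : List (Fin n)) → end v (d ∷ ds) ≡ v →
         end (flipAt d v) (ds ++ d ∷ []) ≡ flipAt d v
rotate {v = v} {d} ds closed = trans (end-++ (flipAt d v) ds) (cong (flipAt d) closed)
  where
  end-++ : ∀ u ds → end u (ds ++ d ∷ []) ≡ flipAt d (end u ds)
  end-++ u []       = refl
  end-++ u (e ∷ ds) = end-++ (flipAt e u) ds

-- By `partner` every direction recurs exactly once, two, three or four places later, so six steps
-- use three directions. Applied to rotations of the walk, these choices either make neighbouring
-- directions equal, produce an excluded third occurrence, or leave one of the four words.
classify : {v : Vertex n} (a b c d e f : Fin n) → end v (a ∷ b ∷ c ∷ d ∷ e ∷ f ∷ []) ≡ v →
  a ≢ b → b ≢ c → c ≢ d → d ≢ e → e ≢ f → f ≢ a →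
  ∃[ t ] ∃[ τ ] Distinct τ × a ∷ b ∷ c ∷ d ∷ e ∷ f ∷ [] ≡ map (dir τ) (word t)
classify a b c d e f cl₀ ab bc cd de ef fa
  with rotate (b ∷ c ∷ d ∷ e ∷ f ∷ []) cl₀
... | cl₁ with rotate (c ∷ d ∷ e ∷ f ∷ a ∷ []) cl₁
... | cl₂ with rotate (d ∷ e ∷ f ∷ a ∷ b ∷ []) cl₂
... | cl₃ with rotate (e ∷ f ∷ a ∷ b ∷ c ∷ []) cl₃
... | cl₄
  with partner a b c d e f cl₀ (ab ∘ sym) (cd ∘ sym) (de ∘ sym) fa
     | partner b c d e f a cl₁ (bc ∘ sym) (de ∘ sym) (ef ∘ sym) ab
     | partner c d e f a b cl₂ (cd ∘ sym) (ef ∘ sym) (fa ∘ sym) bc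
     | partner d e f a b c cl₃ (de ∘ sym) (fa ∘ sym) (ab ∘ sym) cd
     | partner e f a b c d cl₄ (ef ∘ sym) (ab ∘ sym) (bc ∘ sym) de
... | inj₁ (refl , ea) | inj₁ (refl , fb)        | _ | _ | inj₁ (refl , _)        = ⊥-elim (ea refl)
... | inj₁ (refl , ea) | inj₁ (refl , fb)        | _ | _ | inj₂ (inj₁ refl)       = ⊥-elim (de refl)
... | inj₁ (refl , ea) | inj₁ (refl , fb)        | _ | _ | inj₂ (inj₂ (refl , _)) = ⊥-elim (ea refl)
... | inj₁ (refl , ea) | inj₂ (inj₁ refl)        | _ | inj₁ (refl , _)        | _ =
        # 3 , (a , b , d) , (ab , cd , de ∘ sym) , refl
... | inj₁ (refl , ea) | inj₂ (inj₁ refl)        | _ | inj₂ (inj₁ refl)       | _ = ⊥-elim (cd refl)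
... | inj₁ (refl , ea) | inj₂ (inj₁ refl)        | _ | inj₂ (inj₂ (refl , _)) | _ = ⊥-elim (de refl)
... | inj₁ (refl , ea) | inj₂ (inj₂ (refl , db)) | _ | inj₁ (p , _)           | _ = ⊥-elim (db (sym p))
... | inj₁ (refl , ea) | inj₂ (inj₂ (refl , db)) | _ | inj₂ (inj₁ refl)       | _ = ⊥-elim (cd refl)
... | inj₁ (refl , ea) | inj₂ (inj₂ (refl , db)) | _ | inj₂ (inj₂ (p , _))    | _ = ⊥-elim (db (sym p))
... | inj₂ (inj₁ refl) | inj₁ (refl , fb)        | _ | _ | _ = ⊥-elim (ab refl)
... | inj₂ (inj₁ refl) | inj₂ (inj₁ refl)        | inj₁ (refl , _)        | _ | _ = ⊥-elim (bc refl)
... | inj₂ (inj₁ refl) | inj₂ (inj₁ refl)        | inj₂ (inj₁ refl)       | _ | _ =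
        # 0 , (a , b , c) , (ab , cd ∘ sym , bc) , refl
... | inj₂ (inj₁ refl) | inj₂ (inj₁ refl)        | inj₂ (inj₂ (refl , _)) | _ | _ = ⊥-elim (cd refl)
... | inj₂ (inj₁ refl) | inj₂ (inj₂ (refl , db)) | inj₁ (refl , _)        | _ | _ =
        # 1 , (a , b , c) , (ab , cd ∘ sym , bc) , refl
... | inj₂ (inj₁ refl) | inj₂ (inj₂ (refl , db)) | inj₂ (inj₁ refl)       | _ | _ = ⊥-elim (bc refl)
... | inj₂ (inj₁ refl) | inj₂ (inj₂ (refl , db)) | inj₂ (inj₂ (refl , _)) | _ | _ = ⊥-elim (cd refl)
... | inj₂ (inj₂ (refl , ca)) | inj₁ (refl , fb) | inj₁ (p , _)           | _ | _ = ⊥-elim (ca (sym p))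
... | inj₂ (inj₂ (refl , ca)) | inj₁ (refl , fb) | inj₂ (inj₁ refl)       | _ | _ =
        # 2 , (a , b , c) , (ab , ca ∘ sym , bc) , refl
... | inj₂ (inj₂ (refl , ca)) | inj₁ (refl , fb) | inj₂ (inj₂ (p , _))    | _ | _ = ⊥-elim (ca (sym p))
... | inj₂ (inj₂ (refl , ca)) | inj₂ (inj₁ refl) | _ | _ | _ = ⊥-elim (ab refl)
... | inj₂ (inj₂ (refl , ca)) | inj₂ (inj₂ (refl , db)) | inj₁ (p , _)    | _ | _ = ⊥-elim (ca (sym p))
... | inj₂ (inj₂ (refl , ca)) | inj₂ (inj₂ (refl , db)) | inj₂ (inj₁ refl)| _ | _ = ⊥-elim (bc refl)
... | inj₂ (inj₂ (refl , ca)) | inj₂ (inj₂ (refl , db)) | inj₂ (inj₂ (p , _)) | _ | _ = ⊥-elim (ca (sym p))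

hexagon-complete : {F : List (Edge n)} → F ⊆ cubeEdges n → {w : List (Vertex n)} → IsHexagonIn F w →
  ∃[ t ] ∃[ τ ] ∃[ v ] Distinct τ × w ≡ hexagon (t , τ , v)
hexagon-complete {n} F⊆ {a ∷ b ∷ c ∷ d ∷ e ∷ f ∷ []}
  (refl , (_ ∷ ac ∷ _ ∷ ae ∷ _) ∷ (_ ∷ bd ∷ _ ∷ bf ∷ _) ∷ (_ ∷ ce ∷ _) ∷ (_ ∷ df ∷ _) ∷ _
  , jab ∷ jbc ∷ jcd ∷ jde ∷ jef ∷ jfa ∷ [])
  with Joins-cube⁻ (Joins-mono F⊆ jab)
... | d₀ , refl with Joins-cube⁻ (Joins-mono F⊆ jbc)
... | d₁ , refl with Joins-cube⁻ (Joins-mono F⊆ jcd)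
... | d₂ , refl with Joins-cube⁻ (Joins-mono F⊆ jde)
... | d₃ , refl with Joins-cube⁻ (Joins-mono F⊆ jef)
... | d₄ , refl with Joins-cube⁻ (Joins-mono F⊆ jfa)
... | d₅ , closed
  with classify d₀ d₁ d₂ d₃ d₄ d₅ (sym closed)
    -- Two equal directions in succession would return to the vertex two places before; the last two
    -- cases go around the closing edge.
    (λ { refl → ac (sym (flip-involutive _ a)) })
    (λ { refl → bd (sym (flip-involutive _ b)) })
    (λ { refl → ce (sym (flip-involutive _ c)) })
    (λ { refl → df (sym (flip-involutive _ d)) })
    (λ { refl → ae (trans closed (flip-involutive _ e)) })
    (λ { refl → bf (trans (cong (flipAt _) closed) (flip-involutive _ f)) })
... | t , τ , dτ , eq = t , τ , a , dτ , cong (walk a) eq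

-- Counting hexagons by their traversals

allTriples : (n : ℕ) → List (Triple n)
allTriples n = cartesianProduct (allFin n) (cartesianProduct (allFin n) (allFin n))

triples : (n : ℕ) → List (Triple n)
triples n = filterᵇ (does ∘ distinct?) (allTriples n)

codes : (n : ℕ) → List (Code n)
codes n = cartesianProduct (allFin 4) (cartesianProduct (triples n) (allVertices n))

∈-triples⁻ : {τ : Triple n} → τ ∈ triples n → Distinct τ
∈-triples⁻ {n} {τ} τ∈ = does⁻ (distinct? τ) (proj₂ (∈-filter⁻ (T? ∘ does ∘ distinct?) {xs = allTriples n} τ∈))

∈-triples⁺ : {τ : Triple n} → Distinct τ → τ ∈ triples n
∈-triples⁺ {τ = i , j , k} d = ∈-filter⁺ (T? ∘ does ∘ distinct?)
  (∈-cartesianProduct⁺ (∈-allFin i) (∈-cartesianProduct⁺ (∈-allFin j) (∈-allFin k)))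
  (does⁺ (distinct? (i , j , k)) d)

Unique-codes : (n : ℕ) → Unique (codes n)
Unique-codes n = UniqueP.cartesianProduct⁺ (UniqueP.allFin⁺ 4) (UniqueP.cartesianProduct⁺
  (UniqueP.filter⁺ (T? ∘ does ∘ distinct?)
    (UniqueP.cartesianProduct⁺ (UniqueP.allFin⁺ n) (UniqueP.cartesianProduct⁺ (UniqueP.allFin⁺ n) (UniqueP.allFin⁺ n))))
  (Unique-allVertices n))

∈-codes⁻ : {x : Code n} → x ∈ codes n → Distinct (proj₁ (proj₂ x))
∈-codes⁻ {n} x∈ = ∈-triples⁻ (proj₁ (∈-cartesianProduct⁻ (triples n) (allVertices n)
  (proj₂ (∈-cartesianProduct⁻ (allFin 4) (cartesianProduct (triples n) (allVertices n)) x∈))))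

∈-codes⁺ : {x : Code n} → Distinct (proj₁ (proj₂ x)) → x ∈ codes n
∈-codes⁺ {x = t , τ , v} d =
  ∈-cartesianProduct⁺ (∈-allFin t) (∈-cartesianProduct⁺ (∈-triples⁺ d) (∈-allVertices v))

-- Injectivity is asked only on the entries of `xs`, because `hexagon` is injective only on codes
-- with three different directions.
Unique-map : (f : A → B) {xs : List A} →
             (∀ {x y} → x ∈ xs → y ∈ xs → f x ≡ f y → x ≡ y) → Unique xs → Unique (map f xs)
Unique-map f inj []       = []
Unique-map f inj (x∉ ∷ u) =
  AllP.map⁺ (All.tabulate λ y∈ eq → All.lookup x∉ y∈ (inj (here refl) (there y∈) eq))
  ∷ Unique-map f (λ p q → inj (there p) (there q)) u

-- One side of the double count of incident pairs of copies and codes: `hexagon` maps the codes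
-- lying on `F` bijectively to its traversals.
traversals-of-copy : {F : List (Edge n)} → F ⊆ cubeEdges n → T (isCycle 6 F) →
                     length (filterᵇ (λ x → onᵇ F (hexagon x)) (codes n)) ≡ 12
traversals-of-copy {n} {F} F⊆ cyc with isCycle⁻ 6 F cyc
... | lF , w , lw , uw , ow = begin
  length X               ≡⟨ length-map hexagon X ⟨
  length (map hexagon X) ≡⟨ hexagon-traversals lF {w} (lw , uw , ow) (map hexagon X) unique sound complete ⟩
  12                     ∎
  where
  open ≡-Reasoning
  T?on = λ (x : Code n) → T? (onᵇ F (hexagon x))
  X = filterᵇ (λ x → onᵇ F (hexagon x)) (codes n)
  dist : ∀ {x} → x ∈ X → Distinct (proj₁ (proj₂ x))
  dist x∈ = ∈-codes⁻ (proj₁ (∈-filter⁻ T?on {xs = codes n} x∈))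
  unique : Unique (map hexagon X)
  unique = Unique-map hexagon (λ x∈ y∈ → hexagon-injective (dist x∈) (dist y∈)) (UniqueP.filter⁺ T?on (Unique-codes n))
  sound : ∀ {v} → v ∈ map hexagon X → IsHexagonIn F v
  sound v∈ with ∈-map⁻ hexagon v∈
  ... | x@(t , τ , v) , x∈ , refl = length-hexagon x , Unique-hexagon t (dist x∈) v
                                  , onᵇ⁻ F (hexagon x) (proj₂ (∈-filter⁻ T?on {xs = codes n} x∈))
  complete : ∀ {v} → IsHexagonIn F v → v ∈ map hexagon X
  complete h with hexagon-complete F⊆ h
  ... | t , τ , v , d , refl = ∈-map⁺ hexagon
          (∈-filter⁺ T?on (∈-codes⁺ {x = t , τ , v} d) (onᵇ⁺ F (hexagon (t , τ , v)) (proj₂ (proj₂ h))))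

-- The other side of the double count: a closed walk lies on at most one copy, the one formed by its
-- own six edges, and on that one exactly if these edges are in `G`.
copies-of-traversal : {G : List (Edge n)} → G ∈ sublists (cubeEdges n) → {w : List (Vertex n)} →
  length w ≡ 6 → Unique w →
  length (filterᵇ (λ F → onᵇ F w) (filterᵇ (isCycle 6) (sublists G))) ≡ 𝟙 (onᵇ G w)
copies-of-traversal {n} {G} G∈ {w@(_ ∷ _ ∷ _ ∷ _ ∷ _ ∷ _ ∷ [])} refl uw = count (onᵇ G w) refl
  where
  uG = Unique-∈-sublists (Unique-cubeEdges n) G∈
  pairs = hexagon-pairs {w = w} refl uw
  T?on = λ F → T? (onᵇ F w)
  copies = filterᵇ (λ F → onᵇ F w) (filterᵇ (isCycle 6) (sublists G))
  unique : Unique copies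
  unique = UniqueP.filter⁺ T?on (UniqueP.filter⁺ (T? ∘ isCycle 6) (Unique-sublists uG))
  split : ∀ {F} → F ∈ copies → F ∈ sublists G × T (isCycle 6 F) × w On F
  split {F} F∈ =
    let F∈S , o = ∈-filter⁻ T?on {xs = filterᵇ (isCycle 6) (sublists G)} F∈
        F∈G , c = ∈-filter⁻ (T? ∘ isCycle 6) {xs = sublists G} F∈S
    in F∈G , c , onᵇ⁻ F w o
  count : ∀ b → onᵇ G w ≡ b → length copies ≡ 𝟙 b
  count false eq = n≤0⇒n≡0 (Unique-⊆⇒length≤ {ys = []} unique λ F∈ →
    let F∈G , _ , o = split F∈
    in ⊥-elim (subst T eq (onᵇ⁺ G w (All.map (Joins-mono (∈-sublists⇒⊆ F∈G)) o))))
  count true eq =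
    let F , F∈G , c , o = cycle-subgraph uG w refl pairs uw (onᵇ⁻ G w (subst T (sym eq) _))
    in Unique-⊆⊇⇒length≡ {ys = F ∷ []} unique ([] ∷ [])
         (λ {F′} F′∈ → let F′∈G , c′ , o′ = split F′∈ in
            here (cycle-subgraph-unique uG oG (cyclicPairs w) pairs F′∈G F∈G
                   (proj₁ (isCycle⁻ 6 F′ c′)) (proj₁ (isCycle⁻ 6 F c)) o′ o))
         λ { (here refl) → ∈-filter⁺ T?on (∈-filter⁺ (T? ∘ isCycle 6) F∈G c) (onᵇ⁺ F w o) }
    where
    oG : Oriented G
    oG p q = Oriented-cubeEdges n (∈-sublists⇒⊆ G∈ p) (∈-sublists⇒⊆ G∈ q)

-- Traversals that start at `v` and meet their directions for the first time in the order of `τ`.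
hexagonsAt : List (Edge n) → Triple n → Vertex n → ℕ
hexagonsAt G τ v = ∑[ t ∈ allFin 4 ] 𝟙 (pathᵇ G v (map (dir τ) (word t)))

∑-rotate : (xs : List A) (ys : List B) (zs : List C) (f : A → B → C → ℕ) →
  ∑[ x ∈ xs ] ∑[ y ∈ ys ] ∑[ z ∈ zs ] f x y z ≡ ∑[ y ∈ ys ] ∑[ z ∈ zs ] ∑[ x ∈ xs ] f x y z
∑-rotate xs ys zs f = trans (∑-swap xs ys _) (∑-cong ys λ {y} _ → ∑-swap xs zs (λ x z → f x y z))

-- 12 = 6 starting vertices × 2 orientations.
hexagon-count : {G : List (Edge n)} → G ∈ sublists (cubeEdges n) →
  numCycles 6 G * 12 ≡ ∑[ τ ∈ triples n ] ∑[ v ∈ allVertices n ] hexagonsAt G τ v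
hexagon-count {n} {G} G∈ = begin
  length copies * 12
    ≡⟨ ∑-const copies 12 ⟨
  ∑[ F ∈ copies ] 12
    ≡⟨ ∑-cong copies (λ {F} F∈ → traversals F F∈) ⟨
  ∑[ F ∈ copies ] length (filterᵇ (λ x → onᵇ F (hexagon x)) (codes n))
    ≡⟨ double-count (λ F x → onᵇ F (hexagon x)) copies (codes n) ⟩
  ∑[ x ∈ codes n ] length (filterᵇ (λ F → onᵇ F (hexagon x)) copies)
    ≡⟨ ∑-cong (codes n) (λ {x} x∈ → copies-of-traversal G∈ (length-hexagon x)
         (Unique-hexagon (proj₁ x) (∈-codes⁻ x∈) (proj₂ (proj₂ x)))) ⟩
  ∑[ x ∈ codes n ] 𝟙 (onᵇ G (hexagon x))
    ≡⟨ ∑-cong (codes n) (λ {x} _ → cong 𝟙 (onᵇ-hexagon G (proj₁ x) (proj₁ (proj₂ x)) (proj₂ (proj₂ x)))) ⟩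
  ∑[ x ∈ codes n ] term x
    ≡⟨ ∑-cartesianProduct (allFin 4) (cartesianProduct (triples n) (allVertices n)) term ⟩
  ∑[ t ∈ allFin 4 ] ∑[ y ∈ cartesianProduct (triples n) (allVertices n) ] term (t , y)
    ≡⟨ ∑-cong (allFin 4) (λ {t} _ → ∑-cartesianProduct (triples n) (allVertices n) (λ y → term (t , y))) ⟩
  ∑[ t ∈ allFin 4 ] ∑[ τ ∈ triples n ] ∑[ v ∈ allVertices n ] term (t , τ , v)
    ≡⟨ ∑-rotate (allFin 4) (triples n) (allVertices n) (λ t τ v → term (t , τ , v)) ⟩
  ∑[ τ ∈ triples n ] ∑[ v ∈ allVertices n ] hexagonsAt G τ v ∎
  where
  open ≡-Reasoning
  copies = filterᵇ (isCycle 6) (sublists G)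
  term : Code n → ℕ
  term (t , τ , v) = 𝟙 (pathᵇ G v (map (dir τ) (word t)))
  traversals : ∀ F → F ∈ copies → length (filterᵇ (λ x → onᵇ F (hexagon x)) (codes n)) ≡ 12
  traversals F F∈ = let F∈G , c = ∈-filter⁻ (T? ∘ isCycle 6) {xs = sublists G} F∈
                    in traversals-of-copy (∈-sublists⇒⊆ G∈ ∘ ∈-sublists⇒⊆ F∈G) c

-- Square-free subgraphs of the 3-dimensional cube

pathIn : (Vertex 3 → Fin 3 → Bool) → Vertex 3 → List (Fin 3) → Bool
pathIn e p []       = true
pathIn e p (d ∷ ds) = e p d ∧ pathIn e (flipAt d p) ds

-- A subgraph of Q₃ by the indicators of its edges in each of the three directions.
cubeGraph : (X Y Z : Bool → Bool → Bool) → Vertex 3 → Fin 3 → Bool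
cubeGraph X Y Z (x ∷ y ∷ z ∷ []) zero             = X y z
cubeGraph X Y Z (x ∷ y ∷ z ∷ []) (suc zero)       = Y x z
cubeGraph X Y Z (x ∷ y ∷ z ∷ []) (suc (suc zero)) = Z x y

faces : List (Vertex 3 × Fin 3 × Fin 3)
faces = (origin , # 0 , # 1) ∷ (flipAt (# 2) origin , # 0 , # 1)
      ∷ (origin , # 0 , # 2) ∷ (flipAt (# 1) origin , # 0 , # 2)
      ∷ (origin , # 1 , # 2) ∷ (flipAt (# 0) origin , # 1 , # 2) ∷ []

hasSquare : (Vertex 3 → Fin 3 → Bool) → Bool
hasSquare e = any (λ (p , a , b) → pathIn e p (a ∷ b ∷ a ∷ b ∷ [])) faces

twoOfThree : Bool → Bool → Bool → ℕ
twoOfThree x y z = 𝟙 (x ∧ y ∧ not z) + 𝟙 (x ∧ not y ∧ z) + 𝟙 (not x ∧ y ∧ z)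

traversals : (Vertex 3 → Fin 3 → Bool) → ℕ
traversals e = ∑[ p ∈ allVertices 3 ] ∑[ t ∈ allFin 4 ] 𝟙 (pathIn e p (word t))

degreeTwo : (Vertex 3 → Fin 3 → Bool) → ℕ
degreeTwo e = ∑[ p ∈ allVertices 3 ] twoOfThree (e p (# 0)) (e p (# 1)) (e p (# 2))

select : Bool → Bool → Bool → Bool → Bool → Bool → Bool
select a b c d false false = a
select a b c d false true  = b
select a b c d true  false = c
select a b c d true  true  = d

fromEdges : Vec Bool 12 → Vertex 3 → Fin 3 → Bool
fromEdges (x₀ ∷ x₁ ∷ x₂ ∷ x₃ ∷ y₀ ∷ y₁ ∷ y₂ ∷ y₃ ∷ z₀ ∷ z₁ ∷ z₂ ∷ z₃ ∷ []) =
  cubeGraph (select x₀ x₁ x₂ x₃) (select y₀ y₁ y₂ y₃) (select z₀ z₁ z₂ z₃)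

cube-check : Vec Bool 12 → Bool
cube-check v = hasSquare (fromEdges v) ∨ (traversals (fromEdges v) ≤ᵇ degreeTwo (fromEdges v))

-- The final `_` is accepted because the test over all 4096 edge sets evaluates to `true`.
cube-checked : All (T ∘ cube-check) (allVertices 12)
cube-checked = AllP.all⁺ cube-check (allVertices 12) _

-- A hexagon of Q₃ is counted twice by traversals (in the direction order of the frame), so this
-- says that a square-free subgraph of Q₃ has at most half as many hexagons as vertices of degree 2.
traversals≤degreeTwo : (X Y Z : Bool → Bool → Bool) → hasSquare (cubeGraph X Y Z) ≡ false →
                       traversals (cubeGraph X Y Z) ≤ degreeTwo (cubeGraph X Y Z)
traversals≤degreeTwo X Y Z sf =
  ≤ᵇ⇒≤ _ _ (subst (λ b → T (b ∨ (traversals (cubeGraph X Y Z) ≤ᵇ degreeTwo (cubeGraph X Y Z)))) sf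
    -- The edge indicators are evaluated only at explicit vertices of Q₃, where `fromEdges` of this
    -- vector reduces to `cubeGraph X Y Z`. Thus the checked fact has the required type without
    -- function extensionality.
    (All.lookup cube-checked (∈-allVertices
      (X false false ∷ X false true ∷ X true false ∷ X true true ∷
       Y false false ∷ Y false true ∷ Y true false ∷ Y true true ∷
       Z false false ∷ Z false true ∷ Z true false ∷ Z true true ∷ []))))

-- The upper bound

edgeAt : List (Edge n) → Triple n → Vertex n → Vertex 3 → Fin 3 → Bool
edgeAt G τ v p d = hasEdge G (embed τ v p) (flipAt (dir τ d) (embed τ v p))

-- Each edge is queried from its endpoint at position `false`, so both endpoints share one of the 12
-- indicators over which the finite check runs.
xEdges yEdges zEdges : List (Edge n) → Triple n → Vertex n → Bool → Bool → Bool
xEdges G τ v y z = hasEdge G (embed τ v (false ∷ y ∷ z ∷ [])) (embed τ v (true ∷ y ∷ z ∷ []))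
yEdges G τ v x z = hasEdge G (embed τ v (x ∷ false ∷ z ∷ [])) (embed τ v (x ∷ true ∷ z ∷ []))
zEdges G τ v x y = hasEdge G (embed τ v (x ∷ y ∷ false ∷ [])) (embed τ v (x ∷ y ∷ true ∷ []))

cubeAt : List (Edge n) → Triple n → Vertex n → Vertex 3 → Fin 3 → Bool
cubeAt G τ v = cubeGraph (xEdges G τ v) (yEdges G τ v) (zEdges G τ v)

edgeAt≡cubeAt : (G : List (Edge n)) (τ : Triple n) (v : Vertex n) (p : Vertex 3) (d : Fin 3) →
                edgeAt G τ v p d ≡ cubeAt G τ v p d
edgeAt≡cubeAt G τ v p d = trans (cong (hasEdge G (embed τ v p)) (flip-embed τ v d p)) (symmetric p d)
  where
  symmetric : ∀ p d → hasEdge G (embed τ v p) (embed τ v (flipAt d p)) ≡ cubeAt G τ v p d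
  symmetric (false ∷ y ∷ z ∷ []) zero             = refl
  symmetric (true  ∷ y ∷ z ∷ []) zero             = hasEdge-sym G _ _
  symmetric (x ∷ false ∷ z ∷ []) (suc zero)       = refl
  symmetric (x ∷ true  ∷ z ∷ []) (suc zero)       = hasEdge-sym G _ _
  symmetric (x ∷ y ∷ false ∷ []) (suc (suc zero)) = refl
  symmetric (x ∷ y ∷ true  ∷ []) (suc (suc zero)) = hasEdge-sym G _ _

pathᵇ-embed : (G : List (Edge n)) (τ : Triple n) (v : Vertex n) (p : Vertex 3) (ds : List (Fin 3)) →
              pathᵇ G (embed τ v p) (map (dir τ) ds) ≡ pathIn (cubeAt G τ v) p ds
pathᵇ-embed G τ v p []       = refl
pathᵇ-embed G τ v p (d ∷ ds) = cong₂ _∧_ (edgeAt≡cubeAt G τ v p d)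
  (trans (cong (λ u → pathᵇ G u (map (dir τ) ds)) (flip-embed τ v d p)) (pathᵇ-embed G τ v (flipAt d p) ds))

cycleFree⇒no-cycle : (m : ℕ) (G : List (Edge n)) {F : List (Edge n)} → numCycles m G ≡ 0 → F ∈ sublists G → ¬ T (isCycle m F)
cycleFree⇒no-cycle m G {F} free F∈ c =
  n≮0 (subst (1 ≤_) free (Unique-⊆⇒length≤ {xs = F ∷ []} ([] ∷ [])
    λ { (here refl) → ∈-filter⁺ (T? ∘ isCycle m) F∈ c }))

-- The embedding keeps the four corners of a face distinct, so a face with all its edges in `G`
-- would be a copy of C₄.
no-square : {G : List (Edge n)} → Unique G → numCycles 4 G ≡ 0 → {τ : Triple n} → Distinct τ → (v : Vertex n)
  (p : Vertex 3) (a b : Fin 3) → Unique (walk p (a ∷ b ∷ a ∷ b ∷ [])) → end p (a ∷ b ∷ a ∷ b ∷ []) ≡ p →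
  ¬ T (pathIn (cubeAt G τ v) p (a ∷ b ∷ a ∷ b ∷ []))
no-square {G = G} uG free {τ} dτ v p a b u closed path =
  let F , F∈ , c , _ = cycle-subgraph uG w refl (square-pairs uw) uw
        (onᵇ⁻ G w (subst T (sym (onᵇ-walk₄ G {d = dir τ b}
          (trans (end-embed τ v p ds) (cong (embed τ v) closed))))
          (subst T (sym (pathᵇ-embed G τ v p ds)) path)))
  in cycleFree⇒no-cycle 4 G free F∈ c
  where
  ds = a ∷ b ∷ a ∷ b ∷ []
  w = walk (embed τ v p) (map (dir τ) ds)
  uw : Unique w
  uw = subst Unique (sym (walk-embed τ v p ds)) (UniqueP.map⁺ (embed-injective dτ v) u)

not-T⇒≡false : {b : Bool} → ¬ T b → b ≡ false
not-T⇒≡false {false} _ = refl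
not-T⇒≡false {true}  h = ⊥-elim (h _)

squareFree : {G : List (Edge n)} → Unique G → numCycles 4 G ≡ 0 → {τ : Triple n} → Distinct τ → (v : Vertex n) →
             hasSquare (cubeAt G τ v) ≡ false
squareFree {G = G} uG free {τ} dτ v = not-T⇒≡false λ t →
  let (p , a , b) , f∈ , path = find (any⁻ (λ (p , a , b) → pathIn (cubeAt G τ v) p (a ∷ b ∷ a ∷ b ∷ [])) faces t)
      u , closed = All.lookup faces-closed f∈
  in no-square uG free dτ v p a b u closed path
  where
  faces-closed : All (λ (p , a , b) → Unique (walk p (a ∷ b ∷ a ∷ b ∷ [])) × end p (a ∷ b ∷ a ∷ b ∷ []) ≡ p) faces
  faces-closed = from-yes (All.all? (λ (p , a , b) →
    allPairs? (λ u v → ¬? (≡-dec B._≟_ u v)) (walk p (a ∷ b ∷ a ∷ b ∷ [])) ×-dec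
    ≡-dec B._≟_ (end p (a ∷ b ∷ a ∷ b ∷ [])) p) faces)

-- Averaging over the subcubes in given directions

∑-flipIf : (b : Bool) (i : Fin n) (f : Vertex n → ℕ) →
           ∑[ v ∈ allVertices n ] f (flipIf b i v) ≡ ∑ (allVertices n) f
∑-flipIf true  i f = ∑-flip i f
∑-flipIf false i f = refl

∑-embed : (τ : Triple n) (p : Vertex 3) (f : Vertex n → ℕ) →
          ∑[ v ∈ allVertices n ] f (embed τ v p) ≡ ∑ (allVertices n) f
∑-embed (i , j , k) (x ∷ y ∷ z ∷ []) f =
  trans (∑-flipIf z k (λ v → f (flipIf x i (flipIf y j v))))
        (trans (∑-flipIf y j (λ v → f (flipIf x i v))) (∑-flipIf x i f))

-- Each of the eight positions `p` contributes the full sum, since `embed` permutes the vertices.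
-- For distinct directions the inner sum is taken over the subcube through `v`.
∑-cube : (τ : Triple n) (f : Vertex n → ℕ) →
         ∑[ v ∈ allVertices n ] ∑[ p ∈ allVertices 3 ] f (embed τ v p) ≡ 8 * ∑ (allVertices n) f
∑-cube {n} τ f = begin
  ∑[ v ∈ allVertices n ] ∑[ p ∈ allVertices 3 ] f (embed τ v p) ≡⟨ ∑-swap (allVertices n) (allVertices 3) (λ v p → f (embed τ v p)) ⟩
  ∑[ p ∈ allVertices 3 ] ∑[ v ∈ allVertices n ] f (embed τ v p) ≡⟨ ∑-cong (allVertices 3) (λ {p} _ → ∑-embed τ p f) ⟩
  ∑[ p ∈ allVertices 3 ] ∑ (allVertices n) f                    ≡⟨ ∑-const (allVertices 3) (∑ (allVertices n) f) ⟩
  8 * ∑ (allVertices n) f                                       ∎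
  where open ≡-Reasoning

hasEdgeIn : List (Edge n) → Vertex n → Fin n → Bool
hasEdgeIn G v i = hasEdge G v (flipAt i v)

degreeTwoAt : List (Edge n) → Triple n → Vertex n → ℕ
degreeTwoAt G (i , j , k) v = twoOfThree (hasEdgeIn G v i) (hasEdgeIn G v j) (hasEdgeIn G v k)

-- A vertex of degree 3 in its subcube may lie on a hexagon, so the inequality can fail at a single
-- `v`. Both sides are therefore multiplied by 8 and compared subcube by subcube.
hexagons≤degreeTwo : {G : List (Edge n)} → Unique G → numCycles 4 G ≡ 0 → {τ : Triple n} → Distinct τ →
  ∑[ v ∈ allVertices n ] hexagonsAt G τ v ≤ ∑[ v ∈ allVertices n ] degreeTwoAt G τ v
hexagons≤degreeTwo {n} {G} uG free {τ} dτ = *-cancelˡ-≤ 8 (begin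
  8 * ∑[ v ∈ allVertices n ] hexagonsAt G τ v
    ≡⟨ ∑-cube τ (hexagonsAt G τ) ⟨
  ∑[ v ∈ allVertices n ] ∑[ p ∈ allVertices 3 ] hexagonsAt G τ (embed τ v p)
    ≡⟨ ∑-cong (allVertices n) (λ {v} _ → ∑-cong (allVertices 3) λ {p} _ → ∑-cong (allFin 4) λ {t} _ →
         cong 𝟙 (pathᵇ-embed G τ v p (word t))) ⟩
  ∑[ v ∈ allVertices n ] traversals (cubeAt G τ v)
    ≤⟨ ∑-mono (allVertices n) (λ {v} _ → traversals≤degreeTwo (xEdges G τ v) (yEdges G τ v) (zEdges G τ v) (squareFree uG free dτ v)) ⟩
  ∑[ v ∈ allVertices n ] degreeTwo (cubeAt G τ v)
    ≡⟨ ∑-cong (allVertices n) (λ {v} _ → ∑-cong (allVertices 3) λ {p} _ → degree v p) ⟨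
  ∑[ v ∈ allVertices n ] ∑[ p ∈ allVertices 3 ] degreeTwoAt G τ (embed τ v p)
    ≡⟨ ∑-cube τ (degreeTwoAt G τ) ⟩
  8 * ∑[ v ∈ allVertices n ] degreeTwoAt G τ v ∎)
  where
  open ≤-Reasoning
  degree : ∀ v p → degreeTwoAt G τ (embed τ v p) ≡
           twoOfThree (cubeAt G τ v p (# 0)) (cubeAt G τ v p (# 1)) (cubeAt G τ v p (# 2))
  degree v p rewrite sym (edgeAt≡cubeAt G τ v p (# 0)) | sym (edgeAt≡cubeAt G τ v p (# 1))
                   | sym (edgeAt≡cubeAt G τ v p (# 2)) = refl

-- Triples of directions with exactly two edges at a vertex

𝟙-∧ : (x y z : Bool) → 𝟙 (x ∧ y ∧ z) ≡ 𝟙 x * (𝟙 y * 𝟙 z)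
𝟙-∧ false y     z     = refl
𝟙-∧ true  false z     = refl
𝟙-∧ true  true  false = refl
𝟙-∧ true  true  true  = refl

∑-product : (xs : List A) (ys : List B) (zs : List C) (f : A → ℕ) (g : B → ℕ) (h : C → ℕ) →
  ∑[ x ∈ xs ] ∑[ y ∈ ys ] ∑[ z ∈ zs ] (f x * (g y * h z)) ≡ ∑ xs f * (∑ ys g * ∑ zs h)
∑-product xs ys zs f g h = begin
  ∑[ x ∈ xs ] ∑[ y ∈ ys ] ∑[ z ∈ zs ] (f x * (g y * h z))
    ≡⟨ ∑-cong xs (λ {x} _ → ∑-cong ys λ {y} _ →
         trans (∑-*ˡ zs (f x) (λ z → g y * h z)) (cong (f x *_) (∑-*ˡ zs (g y) h))) ⟩
  ∑[ x ∈ xs ] ∑[ y ∈ ys ] (f x * (g y * ∑ zs h))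
    ≡⟨ ∑-cong xs (λ {x} _ → trans (∑-*ˡ ys (f x) (λ y → g y * ∑ zs h)) (cong (f x *_) (∑-*ʳ ys (∑ zs h) g))) ⟩
  ∑[ x ∈ xs ] (f x * (∑ ys g * ∑ zs h))
    ≡⟨ ∑-*ʳ xs (∑ ys g * ∑ zs h) f ⟩
  ∑ xs f * (∑ ys g * ∑ zs h) ∎
  where open ≡-Reasoning

∑-triples : (f : Fin n → Fin n → Fin n → ℕ) →
  ∑ (allTriples n) (λ (i , j , k) → f i j k)
  ≡ ∑[ i ∈ allFin n ] ∑[ j ∈ allFin n ] ∑[ k ∈ allFin n ] f i j k
∑-triples {n} f = trans (∑-cartesianProduct (allFin n) (cartesianProduct (allFin n) (allFin n)) _)
  (∑-cong (allFin n) λ {i} _ → ∑-cartesianProduct (allFin n) (allFin n) _)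

length-allFin : (n : ℕ) → length (allFin n) ≡ n
length-allFin n = length-tabulate id

degrees-sum : (g : Fin n → Bool) → ∑[ i ∈ allFin n ] 𝟙 (g i) + ∑[ i ∈ allFin n ] 𝟙 (not (g i)) ≡ n
degrees-sum {n} g = begin
  ∑[ i ∈ allFin n ] 𝟙 (g i) + ∑[ i ∈ allFin n ] 𝟙 (not (g i)) ≡⟨ ∑-+ (allFin n) _ _ ⟨
  ∑[ i ∈ allFin n ] (𝟙 (g i) + 𝟙 (not (g i)))                 ≡⟨ ∑-cong (allFin n) (λ {i} _ → total (g i)) ⟩
  ∑[ i ∈ allFin n ] 1                                         ≡⟨ ∑-const (allFin n) 1 ⟩
  length (allFin n) * 1                                       ≡⟨ *-identityʳ _ ⟩
  length (allFin n)                                           ≡⟨ length-allFin n ⟩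
  n                                                           ∎
  where
  open ≡-Reasoning
  total : ∀ b → 𝟙 b + 𝟙 (not b) ≡ 1
  total true  = refl
  total false = refl

2mn≤m²+n² : ∀ m n → 2 * (m * n) ≤ m * m + n * n
2mn≤m²+n² m n with ≤-total m n
... | inj₁ m≤n with d , refl ← m≤n⇒∃[o]m+o≡n m≤n =
      ≤-trans (m≤m+n _ (d * d)) (≤-reflexive (solve 2 (λ m d →
        con 2 :* (m :* (m :+ d)) :+ d :* d := m :* m :+ (m :+ d) :* (m :+ d)) refl m d))
... | inj₂ n≤m with d , refl ← m≤n⇒∃[o]m+o≡n n≤m =
      ≤-trans (m≤m+n _ (d * d)) (≤-reflexive (solve 2 (λ n d →
        con 2 :* ((n :+ d) :* n) :+ d :* d := (n :+ d) :* (n :+ d) :+ n :* n) refl n d))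

-- The cube expands to d³ + 3d²e + 3de² + e³, and d³ + de² ≥ 2d²e supplies the missing two terms.
-- The best factor would be 27/4; 5 leads to the density 3/20, which lies below 13/80.
5d²e≤[d+e]³ : ∀ d e → 5 * (d * (d * e)) ≤ (d + e) * ((d + e) * (d + e))
5d²e≤[d+e]³ d e = begin
  5 * (d * (d * e))
    ≡⟨ solve 2 (λ d e → con 5 :* (d :* (d :* e)) := d :* (con 2 :* (d :* e)) :+ con 3 :* (d :* (d :* e))) refl d e ⟩
  d * (2 * (d * e)) + 3 * (d * (d * e))
    ≤⟨ +-monoˡ-≤ _ (*-monoʳ-≤ d (2mn≤m²+n² d e)) ⟩
  d * (d * d + e * e) + 3 * (d * (d * e))
    ≤⟨ m≤m+n _ (2 * (d * (e * e)) + e * (e * e)) ⟩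
  d * (d * d + e * e) + 3 * (d * (d * e)) + (2 * (d * (e * e)) + e * (e * e))
    ≡⟨ solve 2 (λ d e → d :* (d :* d :+ e :* e) :+ con 3 :* (d :* (d :* e)) :+
                        (con 2 :* (d :* (e :* e)) :+ e :* (e :* e))
                     := (d :+ e) :* ((d :+ e) :* (d :+ e))) refl d e ⟩
  (d + e) * ((d + e) * (d + e)) ∎
  where open ≤-Reasoning

-- Admitting triples with repeated entries turns the sum into products. If `d` directions at `v`
-- carry an edge and `e` do not, there are three places for the missing edge, giving 3d²e; this
-- bounds the six orderings of each of the C(d,2)e unordered triples.
degreeTwo-bound : (G : List (Edge n)) (v : Vertex n) →
                  5 * ∑[ τ ∈ triples n ] degreeTwoAt G τ v ≤ 3 * (n * (n * n))
degreeTwo-bound {n} G v = begin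
  5 * ∑[ τ ∈ triples n ] degreeTwoAt G τ v
    ≤⟨ *-monoʳ-≤ 5 (∑-filterᵇ-≤ (does ∘ distinct?) (allTriples n) (λ τ → degreeTwoAt G τ v)) ⟩
  5 * ∑ (allTriples n) (λ τ → degreeTwoAt G τ v)
    ≡⟨ cong (5 *_) (∑-triples (λ i j k → degreeTwoAt G (i , j , k) v)) ⟩
  5 * ∑[ i ∈ allFin n ] ∑[ j ∈ allFin n ] ∑[ k ∈ allFin n ] twoOfThree (g i) (g j) (g k)
    ≡⟨ cong (5 *_) (∑-cong (allFin n) λ {i} _ → ∑-cong (allFin n) λ {j} _ → ∑-cong (allFin n) λ {k} _ →
         cong₂ _+_ (cong₂ _+_ (𝟙-∧ (g i) (g j) (not (g k))) (𝟙-∧ (g i) (not (g j)) (g k)))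
                   (𝟙-∧ (not (g i)) (g j) (g k))) ⟩
  5 * ∑[ i ∈ allFin n ] ∑[ j ∈ allFin n ] ∑[ k ∈ allFin n ] (a i j k + b i j k + c i j k)
    ≡⟨ cong (5 *_) (split₃ _ _) ⟩
  5 * (∑³ (λ i j k → a i j k + b i j k) + ∑³ c)
    ≡⟨ cong (λ s → 5 * (s + ∑³ c)) (split₃ a b) ⟩
  5 * (∑³ a + ∑³ b + ∑³ c)
    ≡⟨ cong (5 *_) (cong₂ _+_ (cong₂ _+_ (prod 𝟙g 𝟙g 𝟙ḡ) (prod 𝟙g 𝟙ḡ 𝟙g)) (prod 𝟙ḡ 𝟙g 𝟙g)) ⟩
  5 * (d * (d * e) + d * (e * d) + e * (d * d))
    ≡⟨ solve 2 (λ d e → con 5 :* (d :* (d :* e) :+ d :* (e :* d) :+ e :* (d :* d))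
                     := con 3 :* (con 5 :* (d :* (d :* e)))) refl d e ⟩
  3 * (5 * (d * (d * e)))
    ≤⟨ *-monoʳ-≤ 3 (5d²e≤[d+e]³ d e) ⟩
  3 * ((d + e) * ((d + e) * (d + e)))
    ≡⟨ cong (λ m → 3 * (m * (m * m))) (degrees-sum g) ⟩
  3 * (n * (n * n)) ∎
  where
  open ≤-Reasoning
  g = hasEdgeIn G v
  𝟙g 𝟙ḡ : Fin n → ℕ
  𝟙g i = 𝟙 (g i)
  𝟙ḡ i = 𝟙 (not (g i))
  d = ∑ (allFin n) 𝟙g
  e = ∑ (allFin n) 𝟙ḡ
  a b c : Fin n → Fin n → Fin n → ℕ
  a i j k = 𝟙g i * (𝟙g j * 𝟙ḡ k)
  b i j k = 𝟙g i * (𝟙ḡ j * 𝟙g k)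
  c i j k = 𝟙ḡ i * (𝟙g j * 𝟙g k)
  ∑³ : (Fin n → Fin n → Fin n → ℕ) → ℕ
  ∑³ f = ∑[ i ∈ allFin n ] ∑[ j ∈ allFin n ] ∑[ k ∈ allFin n ] f i j k
  split₃ : ∀ f g → ∑³ (λ i j k → f i j k + g i j k) ≡ ∑³ f + ∑³ g
  split₃ f g = trans (∑-cong (allFin n) λ {i} _ → trans (∑-cong (allFin n) λ {j} _ → ∑-+ (allFin n) (f i j) (g i j))
    (∑-+ (allFin n) _ _)) (∑-+ (allFin n) _ _)
  prod = ∑-product (allFin n) (allFin n) (allFin n)

-- The factor 20 is 12 · 5/3: 12 traversals per hexagon, and at most 3n³/5 triples per vertex by
-- `degreeTwo-bound`.
hexagons-upper : {G : List (Edge n)} → G ∈ sublists (cubeEdges n) → numCycles 4 G ≡ 0 →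
                 20 * numCycles 6 G ≤ n * (n * n) * length (allVertices n)
hexagons-upper {n} {G} G∈ free = *-cancelˡ-≤ 3 (begin
  3 * (20 * numCycles 6 G)
    ≡⟨ solve 1 (λ N → con 3 :* (con 20 :* N) := con 5 :* (N :* con 12)) refl (numCycles 6 G) ⟩
  5 * (numCycles 6 G * 12)
    ≡⟨ cong (5 *_) (hexagon-count G∈) ⟩
  5 * ∑[ τ ∈ triples n ] ∑[ v ∈ allVertices n ] hexagonsAt G τ v
    ≤⟨ *-monoʳ-≤ 5 (∑-mono (triples n) λ τ∈ →
         hexagons≤degreeTwo (Unique-∈-sublists (Unique-cubeEdges n) G∈) free (∈-triples⁻ τ∈)) ⟩
  5 * ∑[ τ ∈ triples n ] ∑[ v ∈ allVertices n ] degreeTwoAt G τ v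
    ≡⟨ cong (5 *_) (∑-swap (triples n) (allVertices n) (degreeTwoAt G)) ⟩
  5 * ∑[ v ∈ allVertices n ] ∑[ τ ∈ triples n ] degreeTwoAt G τ v
    ≡⟨ ∑-*ˡ (allVertices n) 5 _ ⟨
  ∑[ v ∈ allVertices n ] (5 * ∑[ τ ∈ triples n ] degreeTwoAt G τ v)
    ≤⟨ ∑-mono (allVertices n) (λ {v} _ → degreeTwo-bound G v) ⟩
  ∑[ v ∈ allVertices n ] (3 * (n * (n * n)))
    ≡⟨ ∑-const (allVertices n) _ ⟩
  length (allVertices n) * (3 * (n * (n * n)))
    ≡⟨ solve 2 (λ V N → V :* (con 3 :* N) := con 3 :* (N :* V)) refl (length (allVertices n)) (n * (n * n)) ⟩
  3 * (n * (n * n) * length (allVertices n)) ∎)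
  where open ≤-Reasoning

-- The lower bound

-- The offset `b` lets one function describe both level graphs. It also carries the parity of a base
-- vertex over to positions in Q₃, as in `parity-embed`.
parity : Bool → Vertex n → Bool
parity b []      = b
parity b (x ∷ v) = x xor parity b v

parity-flip : (b : Bool) (i : Fin n) (v : Vertex n) → parity b (flipAt i v) ≡ not (parity b v)
parity-flip b zero    (true  ∷ v) = sym (not-involutive _)
parity-flip b zero    (false ∷ v) = refl
parity-flip b (suc i) (true  ∷ v) = cong not (parity-flip b i v)
parity-flip b (suc i) (false ∷ v) = parity-flip b i v

parity-not : (v : Vertex n) → parity true v ≡ not (parity false v)
parity-not []          = refl
parity-not (true  ∷ v) = cong not (parity-not v)
parity-not (false ∷ v) = parity-not v

-- Edges whose lower endpoint has weight of parity b: between levels 2k and 2k+1 for b = false,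
-- between levels 2k+1 and 2k+2 for b = true.
levels : Bool → (n : ℕ) → List (Edge n)
levels b n = filterᵇ (λ e → not (parity b (proj₁ e))) (cubeEdges n)

-- A criterion that does not ask which end is the lower one: at the lower endpoint of an edge of the
-- graph both the parity and the coordinate are `false`, at the upper one both are `true`.
Joins-levels⁻ : (b : Bool) {u w : Vertex n} → Joins (levels b n) (u , w) →
                ∃[ i ] w ≡ flipAt i u × parity b u ≡ u ! i
Joins-levels⁻ {n} b {u} {w} (e , e∈ , m)
  with ∈-filter⁻ (T? ∘ λ e → not (parity b (proj₁ e))) {xs = cubeEdges n} e∈
... | e∈Q , even with ∈-cubeEdges⁻ e∈Q | m
... | i , low , eq   | inj₁ refl = i , eq , trans (even⇒ (parity b u) even) (sym low)
  where
  even⇒ : ∀ c → T (not c) → c ≡ false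
  even⇒ false _ = refl
... | i , low , refl | inj₂ refl =
  i , sym (flip-involutive i w) , trans (parity-flip b i w) (trans (even⇒ (parity b w) even)
        (trans (cong not (sym low)) (sym (!-flip-same i w))))
  where
  even⇒ : ∀ c → T (not c) → not c ≡ true
  even⇒ false _ = refl

Joins-levels⁺ : (b : Bool) (u : Vertex n) (i : Fin n) → parity b u ≡ u ! i → Joins (levels b n) (u , flipAt i u)
Joins-levels⁺ b u i eq with u ! i in ui
... | false = _ , ∈-filter⁺ (T? ∘ λ e → not (parity b (proj₁ e))) (∈-cubeEdges⁺ ui)
                    (subst (T ∘ not) (sym eq) _) , inj₁ refl
... | true  = _ , ∈-filter⁺ (T? ∘ λ e → not (parity b (proj₁ e)))
                    (∈-cubeEdges⁺ {u = flipAt i u} {i} (trans (!-flip-same i u) (cong not ui)))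
                    (subst (T ∘ not) (sym (trans (parity-flip b i u) (cong not eq))) _)
                , inj₂ (cong (flipAt i u ,_) (flip-involutive i u))

hasEdge-levels : (b : Bool) (u : Vertex n) (i : Fin n) →
                 hasEdgeIn (levels b n) u i ≡ not (parity b u xor (u ! i))
hasEdge-levels {n} b u i = T-⇔⇒≡ to from
  where
  same : ∀ {x y} → x ≡ y → T (not (x xor y))
  same {true}  refl = _
  same {false} refl = _
  same⁻ : ∀ x y → T (not (x xor y)) → x ≡ y
  same⁻ true  true  _ = refl
  same⁻ false false _ = refl
  to : T (hasEdge (levels b n) u (flipAt i u)) → T (not (parity b u xor (u ! i)))
  to t with Joins-levels⁻ b (hasEdge⁻ (levels b n) (u , flipAt i u) t)
  ... | j , eq , p = subst (λ j → T (not (parity b u xor (u ! j)))) (sym (flip-injective u eq)) (same p)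
  from : T (not (parity b u xor (u ! i))) → T (hasEdge (levels b n) u (flipAt i u))
  from t = hasEdge⁺ (levels b n) (u , flipAt i u) (Joins-levels⁺ b u i (same⁻ _ _ t))

no-backtracking : {i j : Fin n} {v : Vertex n} → v ≢ flipAt j (flipAt i v) → j ≢ i
no-backtracking {i = i} {v = v} v≢ refl = v≢ (sym (flip-involutive i v))

-- In a square with directions i, j, i, j the opposite vertices `u` and `w` have equal parity but
-- differ in coordinate i, although the edges in direction i at both require parity and coordinate
-- to agree. Other direction patterns do not close up: coordinate i would not be restored, or
-- coordinate j would change only once.
levels-square-free : (b : Bool) {F : List (Edge n)} → F ⊆ levels b n → ¬ T (isCycle 4 F)
levels-square-free b {F} F⊆ cyc with isCycle⁻ 4 F cyc
... | _ , u ∷ v ∷ w ∷ x ∷ [] , refl , (_ ∷ u≢w ∷ _) ∷ (_ ∷ v≢x ∷ _) ∷ _ , uv ∷ vw ∷ wx ∷ xu ∷ []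
  with Joins-levels⁻ b (Joins-mono F⊆ uv)
... | i , refl , pu with Joins-levels⁻ b (Joins-mono F⊆ vw)
... | j , refl , pv with Joins-levels⁻ b (Joins-mono F⊆ wx)
... | k , refl , pw with Joins-levels⁻ b (Joins-mono F⊆ xu)
... | l , closed , px with k Fin.≟ i
...   | yes refl = not-¬ refl (begin
        u ! i                              ≡⟨ pu ⟨
        parity b u                         ≡⟨ not-involutive _ ⟨
        not (not (parity b u))             ≡⟨ cong not (parity-flip b i u) ⟨
        not (parity b v)                   ≡⟨ parity-flip b j v ⟨
        parity b w                         ≡⟨ pw ⟩
        w ! i                              ≡⟨ !-flip-other (no-backtracking u≢w) v ⟩
        v ! i                              ≡⟨ !-flip-same i u ⟩
        not (u ! i)                        ∎)
  where
  open ≡-Reasoning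
...   | no k≢i with l Fin.≟ i
...     | no l≢i = not-¬ refl (begin
          u ! i                            ≡⟨ cong (_! i) closed ⟩
          flipAt l x ! i                   ≡⟨ !-flip-other l≢i x ⟩
          x ! i                            ≡⟨ !-flip-other k≢i w ⟩
          w ! i                            ≡⟨ !-flip-other (no-backtracking u≢w) v ⟩
          v ! i                            ≡⟨ !-flip-same i u ⟩
          not (u ! i)                      ∎)
  where
  open ≡-Reasoning
...     | yes refl = not-¬ refl (begin
          u ! j                            ≡⟨ cong (_! j) closed ⟩
          flipAt i x ! j                   ≡⟨ !-flip-other (no-backtracking u≢w ∘ sym) x ⟩
          x ! j                            ≡⟨ !-flip-other (no-backtracking v≢x) w ⟩
          w ! j                            ≡⟨ !-flip-same j v ⟩
          not (v ! j)                      ≡⟨ cong not (!-flip-other (no-backtracking u≢w ∘ sym) u) ⟩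
          not (u ! j)                      ∎)
  where
  open ≡-Reasoning

levels∈sublists : (b : Bool) (n : ℕ) → levels b n ∈ sublists (cubeEdges n)
levels∈sublists b n = filterᵇ∈sublists (λ e → not (parity b (proj₁ e))) (cubeEdges n)

levels-cycleFree : (b : Bool) (n : ℕ) → numCycles 4 (levels b n) ≡ 0
levels-cycleFree b n = n≤0⇒n≡0 (Unique-⊆⇒length≤ {ys = []}
  (UniqueP.filter⁺ (T? ∘ isCycle 4) (Unique-sublists (Unique-∈-sublists (Unique-cubeEdges n) (levels∈sublists b n))))
  λ F∈ → let F∈S , c = ∈-filter⁻ (T? ∘ isCycle 4) {xs = sublists (levels b n)} F∈
         in ⊥-elim (levels-square-free b (∈-sublists⇒⊆ F∈S) c))

-- The level graphs inside a subcube

pathIn-cong : {e f : Vertex 3 → Fin 3 → Bool} → (∀ p d → e p d ≡ f p d) →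
              (p : Vertex 3) (ds : List (Fin 3)) → pathIn e p ds ≡ pathIn f p ds
pathIn-cong h p []       = refl
pathIn-cong h p (d ∷ ds) = cong₂ _∧_ (h p d) (pathIn-cong h (flipAt d p) ds)

parity-flipIf : (b x : Bool) (i : Fin n) (v : Vertex n) → parity b (flipIf x i v) ≡ x xor parity b v
parity-flipIf b true  i v = parity-flip b i v
parity-flipIf b false i v = refl

parity-embed : (b : Bool) (τ : Triple n) (v : Vertex n) (p : Vertex 3) →
               parity b (embed τ v p) ≡ parity (parity b v) p
parity-embed b (i , j , k) v (x ∷ y ∷ z ∷ []) =
  trans (parity-flipIf b x i _) (cong (x xor_)
    (trans (parity-flipIf b y j _) (cong (y xor_) (parity-flipIf b z k v))))

-- The restriction of levels b to the subcube through v, given the parity c of v and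
-- the coordinates q of v in the directions of the subcube.
levelCube : Bool → Vertex 3 → Vertex 3 → Fin 3 → Bool
levelCube c q p d = not (parity c p xor ((p ! d) xor (q ! d)))

coordinates : Triple n → Vertex n → Vertex 3
coordinates (i , j , k) v = (v ! i) ∷ (v ! j) ∷ (v ! k) ∷ []

!-coordinates : (τ : Triple n) (v : Vertex n) (d : Fin 3) → v ! dir τ d ≡ coordinates τ v ! d
!-coordinates τ v zero             = refl
!-coordinates τ v (suc zero)       = refl
!-coordinates τ v (suc (suc zero)) = refl

pathᵇ-levels : (b : Bool) {τ : Triple n} → Distinct τ → (v : Vertex n) (p : Vertex 3) (ds : List (Fin 3)) →
  pathᵇ (levels b n) (embed τ v p) (map (dir τ) ds) ≡ pathIn (levelCube (parity b v) (coordinates τ v)) p ds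
pathᵇ-levels {n} b {τ} dτ v p ds = trans (pathᵇ-embed (levels b n) τ v p ds) (pathIn-cong edge p ds)
  where
  edge : ∀ p d → cubeAt (levels b n) τ v p d ≡ levelCube (parity b v) (coordinates τ v) p d
  edge p d = begin
    cubeAt (levels b n) τ v p d
      ≡⟨ edgeAt≡cubeAt (levels b n) τ v p d ⟨
    hasEdgeIn (levels b n) (embed τ v p) (dir τ d)
      ≡⟨ hasEdge-levels b (embed τ v p) (dir τ d) ⟩
    not (parity b (embed τ v p) xor (embed τ v p ! dir τ d))
      ≡⟨ cong not (cong₂ _xor_ (parity-embed b τ v p)
           (trans (!-embed dτ v p d) (cong ((p ! d) xor_) (!-coordinates τ v d)))) ⟩
    levelCube (parity b v) (coordinates τ v) p d ∎
    where open ≡-Reasoning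

-- The values `c` and `not c` stand for the two level graphs, which together contain one induced
-- hexagon of the subcube. In a fixed order of directions it is traversed from two antipodal
-- starting vertices, hence 2. The 16 cases are evaluated.
levelCube-hexagons : (c : Bool) (q : Vertex 3) →
  ∑[ p ∈ allVertices 3 ] (𝟙 (pathIn (levelCube c q) p (word (# 0))) +
                          𝟙 (pathIn (levelCube (not c) q) p (word (# 0)))) ≡ 2
levelCube-hexagons c q = All.lookup
  (All.lookup (from-yes (All.all? (λ c → All.all? (λ q → hexagons c q ≟ 2) (allVertices 3)) (false ∷ true ∷ [])))
    (bool c)) (∈-allVertices q)
  where
  hexagons : Bool → Vertex 3 → ℕ
  hexagons c q = ∑[ p ∈ allVertices 3 ] (𝟙 (pathIn (levelCube c q) p (word (# 0))) +
                                         𝟙 (pathIn (levelCube (not c) q) p (word (# 0))))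
  bool : ∀ c → c ∈ false ∷ true ∷ []
  bool false = here refl
  bool true  = there (here refl)

hexagonsAt≥ : (G : List (Edge n)) (τ : Triple n) (v : Vertex n) →
              𝟙 (pathᵇ G v (map (dir τ) (word (# 0)))) ≤ hexagonsAt G τ v
hexagonsAt≥ G τ v = m≤m+n _ _

-- Each base point sees two traversals of the middle hexagon of its subcube, and each traversal is
-- seen from eight base points; 4 is the quotient of 8 by 2.
levels-hexagons : {τ : Triple n} → Distinct τ →
  length (allVertices n) ≤ 4 * ∑[ v ∈ allVertices n ] (hexagonsAt (levels false n) τ v + hexagonsAt (levels true n) τ v)
levels-hexagons {n} {τ} dτ = *-cancelˡ-≤ 2 (begin
  2 * length (allVertices n)
    ≡⟨ *-comm 2 (length (allVertices n)) ⟩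
  length (allVertices n) * 2
    ≡⟨ ∑-const (allVertices n) 2 ⟨
  ∑[ v ∈ allVertices n ] 2
    ≡⟨ ∑-cong (allVertices n) (λ {v} _ → sym (perCube v)) ⟩
  ∑[ v ∈ allVertices n ] ∑[ p ∈ allVertices 3 ] equators (embed τ v p)
    ≡⟨ ∑-cube τ equators ⟩
  8 * ∑ (allVertices n) equators
    ≤⟨ *-monoʳ-≤ 8 (∑-mono (allVertices n) λ {v} _ →
         +-mono-≤ (hexagonsAt≥ (levels false n) τ v) (hexagonsAt≥ (levels true n) τ v)) ⟩
  8 * total
    ≡⟨ *-assoc 2 4 total ⟩
  2 * (4 * total) ∎)
  where
  open ≤-Reasoning
  total = ∑[ v ∈ allVertices n ] (hexagonsAt (levels false n) τ v + hexagonsAt (levels true n) τ v)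
  equators : Vertex n → ℕ
  equators v = 𝟙 (pathᵇ (levels false n) v (map (dir τ) (word (# 0)))) +
               𝟙 (pathᵇ (levels true n) v (map (dir τ) (word (# 0))))
  perCube : ∀ v → ∑[ p ∈ allVertices 3 ] equators (embed τ v p) ≡ 2
  perCube v = trans (∑-cong (allVertices 3) λ {p} _ → cong₂ _+_
      (cong 𝟙 (pathᵇ-levels false dτ v p (word (# 0))))
      (cong 𝟙 (trans (pathᵇ-levels true dτ v p (word (# 0)))
        (cong (λ c → pathIn (levelCube c (coordinates τ v)) p (word (# 0))) (parity-not v)))))
    (levelCube-hexagons (parity false v) (coordinates τ v))

pathᵇ-cube : (v : Vertex n) (ds : List (Fin n)) → pathᵇ (cubeEdges n) v ds ≡ true
pathᵇ-cube v []       = refl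
pathᵇ-cube {n} v (d ∷ ds) = cong₂ _∧_
  (Equivalence.to T-≡ (hasEdge⁺ (cubeEdges n) (v , flipAt d v) (Joins-cube⁺ v d))) (pathᵇ-cube (flipAt d v) ds)

G∈sublists : (G : List A) → G ∈ sublists G
G∈sublists []      = here refl
G∈sublists (x ∷ G) = ∈-++⁺ʳ (sublists G) (∈-map⁺ (x ∷_) (G∈sublists G))

-- In the full cube all four words can be walked from every vertex in every triple of directions;
-- the factor 3 is 12/4.
cube-hexagons : (n : ℕ) → 3 * numCycles 6 (cubeEdges n) ≡ length (triples n) * length (allVertices n)
cube-hexagons n = *-cancelˡ-≡ _ _ 4 (begin
  4 * (3 * N)
    ≡⟨ solve 1 (λ N → con 4 :* (con 3 :* N) := N :* con 12) refl N ⟩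
  N * 12
    ≡⟨ hexagon-count (G∈sublists (cubeEdges n)) ⟩
  ∑[ τ ∈ triples n ] ∑[ v ∈ allVertices n ] hexagonsAt (cubeEdges n) τ v
    ≡⟨ ∑-cong (triples n) (λ {τ} _ → ∑-cong (allVertices n) λ {v} _ → ∑-cong (allFin 4) λ {t} _ →
         cong 𝟙 (pathᵇ-cube v (map (dir τ) (word t)))) ⟩
  ∑[ τ ∈ triples n ] ∑[ v ∈ allVertices n ] 4
    ≡⟨ ∑-cong (triples n) (λ _ → ∑-const (allVertices n) 4) ⟩
  ∑[ τ ∈ triples n ] (length (allVertices n) * 4)
    ≡⟨ ∑-const (triples n) _ ⟩
  length (triples n) * (length (allVertices n) * 4)
    ≡⟨ solve 2 (λ t v → t :* (v :* con 4) := con 4 :* (t :* v)) refl (length (triples n)) (length (allVertices n)) ⟩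
  4 * (length (triples n) * length (allVertices n)) ∎)
  where
  open ≡-Reasoning
  N = numCycles 6 (cubeEdges n)

hexagons-lower : (n : ℕ) → numCycles 6 (cubeEdges n) ≤ 16 * (numCycles 6 (levels false n) + numCycles 6 (levels true n))
hexagons-lower n = *-cancelˡ-≤ 3 (begin
  3 * numCycles 6 (cubeEdges n)
    ≡⟨ cube-hexagons n ⟩
  length (triples n) * length (allVertices n)
    ≡⟨ ∑-const (triples n) (length (allVertices n)) ⟨
  ∑[ τ ∈ triples n ] length (allVertices n)
    ≤⟨ ∑-mono (triples n) (λ τ∈ → levels-hexagons (∈-triples⁻ τ∈)) ⟩
  ∑[ τ ∈ triples n ] (4 * ∑[ v ∈ allVertices n ] (h₀ τ v + h₁ τ v))
    ≡⟨ ∑-*ˡ (triples n) 4 _ ⟩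
  4 * ∑[ τ ∈ triples n ] ∑[ v ∈ allVertices n ] (h₀ τ v + h₁ τ v)
    ≡⟨ cong (4 *_) (∑-cong (triples n) λ {τ} _ → ∑-+ (allVertices n) (h₀ τ) (h₁ τ)) ⟩
  4 * ∑[ τ ∈ triples n ] (∑ (allVertices n) (h₀ τ) + ∑ (allVertices n) (h₁ τ))
    ≡⟨ cong (4 *_) (∑-+ (triples n) _ _) ⟩
  4 * (∑[ τ ∈ triples n ] ∑ (allVertices n) (h₀ τ) + ∑[ τ ∈ triples n ] ∑ (allVertices n) (h₁ τ))
    ≡⟨ cong (4 *_) (cong₂ _+_ (hexagon-count (levels∈sublists false n)) (hexagon-count (levels∈sublists true n))) ⟨
  4 * (N₀ * 12 + N₁ * 12)
    ≡⟨ solve 2 (λ x y → con 4 :* (x :* con 12 :+ y :* con 12) := con 3 :* (con 16 :* (x :+ y))) refl N₀ N₁ ⟩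
  3 * (16 * (N₀ + N₁)) ∎)
  where
  open ≤-Reasoning
  h₀ = hexagonsAt (levels false n)
  h₁ = hexagonsAt (levels true n)
  N₀ = numCycles 6 (levels false n)
  N₁ = numCycles 6 (levels true n)

-- The number of directions of subcubes

∑-allFin-≤ : (n c : ℕ) (f : Fin n → ℕ) → (∀ i → f i ≤ c) → ∑ (allFin n) f ≤ n * c
∑-allFin-≤ n c f h = begin
  ∑ (allFin n) f          ≤⟨ ∑-mono (allFin n) (λ {i} _ → h i) ⟩
  ∑[ i ∈ allFin n ] c     ≡⟨ ∑-const (allFin n) c ⟩
  length (allFin n) * c   ≡⟨ cong (_* c) (length-allFin n) ⟩
  n * c                   ∎
  where open ≤-Reasoning

∑-≟ : (i : Fin n) → ∑[ j ∈ allFin n ] 𝟙 (does (i Fin.≟ j)) ≤ 1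
∑-≟ {n} i = begin
  ∑[ j ∈ allFin n ] 𝟙 (does (i Fin.≟ j))               ≡⟨ length-filterᵇ-∑ (λ j → does (i Fin.≟ j)) (allFin n) ⟨
  length (filterᵇ (λ j → does (i Fin.≟ j)) (allFin n)) ≤⟨ Unique-⊆⇒length≤ {ys = i ∷ []}
    (UniqueP.filter⁺ (λ j → T? (does (i Fin.≟ j))) (UniqueP.allFin⁺ n))
    (λ {j} j∈ → here (sym (does⁻ (i Fin.≟ j)
      (proj₂ (∈-filter⁻ (λ j → T? (does (i Fin.≟ j))) {xs = allFin n} j∈))))) ⟩
  1                                                    ∎
  where open ≤-Reasoning

-- A union bound over the three coincidences i = j, i = k and j = k, each met by at most n² triples.
-- The correction stands on the right to avoid truncated subtraction.
triples-lower : (n : ℕ) → n * (n * n) ≤ length (triples n) + 3 * (n * n)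
triples-lower n = begin
  n * (n * n)
    ≡⟨ trans (∑-fin (∑[ j ∈ allFin n ] ∑[ k ∈ allFin n ] 1))
         (cong (n *_) (trans (∑-fin (∑[ k ∈ allFin n ] 1)) (cong (n *_) (trans (∑-fin 1) (*-identityʳ n))))) ⟨
  ∑³ (λ i j k → 1)
    ≡⟨ ∑-triples {n} (λ i j k → 1) ⟨
  ∑[ τ ∈ allTriples n ] 1
    ≤⟨ ∑-mono (allTriples n) (λ {τ} _ → split τ) ⟩
  ∑[ τ ∈ allTriples n ] (𝟙 (does (distinct? τ)) + collisions τ)
    ≡⟨ ∑-+ (allTriples n) _ collisions ⟩
  ∑[ τ ∈ allTriples n ] 𝟙 (does (distinct? τ)) + ∑ (allTriples n) collisions
    ≡⟨ cong (_+ ∑ (allTriples n) collisions) (length-filterᵇ-∑ (does ∘ distinct?) (allTriples n)) ⟨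
  length (triples n) + ∑ (allTriples n) collisions
    ≤⟨ +-monoʳ-≤ (length (triples n)) bound ⟩
  length (triples n) + 3 * (n * n) ∎
  where
  open ≤-Reasoning
  ∑³ : (Fin n → Fin n → Fin n → ℕ) → ℕ
  ∑³ f = ∑[ i ∈ allFin n ] ∑[ j ∈ allFin n ] ∑[ k ∈ allFin n ] f i j k
  ∑-fin : ∀ c → ∑[ i ∈ allFin n ] c ≡ n * c
  ∑-fin c = trans (∑-const (allFin n) c) (cong (_* c) (length-allFin n))
  δ : Fin n → Fin n → ℕ
  δ i j = 𝟙 (does (i Fin.≟ j))
  δᵢⱼ δᵢₖ δⱼₖ collisions : Triple n → ℕ
  δᵢⱼ (i , j , k) = δ i j
  δᵢₖ (i , j , k) = δ i k
  δⱼₖ (i , j , k) = δ j k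
  collisions τ = δᵢⱼ τ + (δᵢₖ τ + δⱼₖ τ)
  split : ∀ τ → 1 ≤ 𝟙 (does (distinct? τ)) + collisions τ
  split (i , j , k) with does (i Fin.≟ j) | does (i Fin.≟ k) | does (j Fin.≟ k)
  ... | true  | _     | _     = s≤s z≤n
  ... | false | true  | _     = s≤s z≤n
  ... | false | false | true  = s≤s z≤n
  ... | false | false | false = s≤s z≤n
  boundᵢⱼ : ∑ (allTriples n) δᵢⱼ ≤ n * n
  boundᵢⱼ = begin
    ∑ (allTriples n) δᵢⱼ
      ≡⟨ ∑-triples (λ i j k → δ i j) ⟩
    ∑[ i ∈ allFin n ] ∑[ j ∈ allFin n ] ∑[ k ∈ allFin n ] δ i j
      ≤⟨ ∑-allFin-≤ n n _ (λ i → ≤-trans (≤-reflexive (∑-swap (allFin n) (allFin n) (λ j k → δ i j)))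
           (≤-trans (∑-allFin-≤ n 1 _ (λ k → ∑-≟ i)) (≤-reflexive (*-identityʳ n)))) ⟩
    n * n ∎
  boundᵢₖ : ∑ (allTriples n) δᵢₖ ≤ n * n
  boundᵢₖ = begin
    ∑ (allTriples n) δᵢₖ
      ≡⟨ ∑-triples (λ i j k → δ i k) ⟩
    ∑[ i ∈ allFin n ] ∑[ j ∈ allFin n ] ∑[ k ∈ allFin n ] δ i k
      ≤⟨ ∑-allFin-≤ n n _ (λ i → ≤-trans (∑-allFin-≤ n 1 _ (λ j → ∑-≟ i)) (≤-reflexive (*-identityʳ n))) ⟩
    n * n ∎
  boundⱼₖ : ∑ (allTriples n) δⱼₖ ≤ n * n
  boundⱼₖ = begin
    ∑ (allTriples n) δⱼₖ
      ≡⟨ ∑-triples (λ i j k → δ j k) ⟩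
    ∑[ i ∈ allFin n ] ∑[ j ∈ allFin n ] ∑[ k ∈ allFin n ] δ j k
      ≤⟨ ∑-allFin-≤ n n _ (λ i → ≤-trans (∑-allFin-≤ n 1 _ (λ j → ∑-≟ j)) (≤-reflexive (*-identityʳ n))) ⟩
    n * n ∎
  bound : ∑ (allTriples n) collisions ≤ 3 * (n * n)
  bound = begin
    ∑ (allTriples n) collisions
      ≡⟨ trans (∑-+ (allTriples n) δᵢⱼ _) (cong (∑ (allTriples n) δᵢⱼ +_) (∑-+ (allTriples n) δᵢₖ δⱼₖ)) ⟩
    ∑ (allTriples n) δᵢⱼ + (∑ (allTriples n) δᵢₖ + ∑ (allTriples n) δⱼₖ)
      ≤⟨ +-mono-≤ boundᵢⱼ (+-mono-≤ boundᵢₖ boundⱼₖ) ⟩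
    n * n + (n * n + n * n)
      ≡⟨ solve 1 (λ m → m :+ (m :+ m) := con 3 :* m) refl (n * n) ⟩
    3 * (n * n) ∎

-- The extremal number

≤exCycle : (m k : ℕ) (G : List (Edge n)) {F : List (Edge n)} → F ∈ sublists G → numCycles k F ≡ 0 → numCycles m F ≤ exCycle m k G
≤exCycle m k G {F} F∈ free = maximum (∈-map⁺ (numCycles m)
  (∈-filter⁺ (T? ∘ cycleFree k) F∈ (≡⇒≡ᵇ (numCycles k F) 0 free)))
  where
  maximum : ∀ {x xs} → x ∈ xs → x ≤ foldr _⊔_ 0 xs
  maximum {xs = y ∷ xs} (here refl) = m≤m⊔n y _
  maximum {xs = y ∷ xs} (there x∈)  = ≤-trans (maximum x∈) (m≤n⊔m y _)

exCycle≤ : (m k c b : ℕ) (G : List (Edge n)) →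
           (∀ {F} → F ∈ sublists G → numCycles k F ≡ 0 → c * numCycles m F ≤ b) → c * exCycle m k G ≤ b
exCycle≤ m k c b G h = least (AllP.map⁺ (All.tabulate λ {F} F∈ →
  let F∈G , free = ∈-filter⁻ (T? ∘ cycleFree k) {xs = sublists G} F∈
  in h F∈G (≡ᵇ⇒≡ (numCycles k F) 0 free)))
  where
  least : ∀ {xs} → All (λ x → c * x ≤ b) xs → c * foldr _⊔_ 0 xs ≤ b
  least []                    = ≤-trans (≤-reflexive (*-zeroʳ c)) z≤n
  least {x ∷ xs} (x≤ ∷ xs≤) = ≤-trans (≤-reflexive (*-distribˡ-⊔ c x _)) (⊔-lub x≤ (least xs≤))

-- The hypothesis gives 13t ≥ 13n³ - 39n², and 39n² ≤ n³ from n = 39 = 13 · 3 on. The ratio 13/12 is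
-- that of 13/80 to 3/20.
12n³≤13t : (n t : ℕ) → 39 ≤ n → n * (n * n) ≤ t + 3 * (n * n) → 12 * (n * (n * n)) ≤ 13 * t
12n³≤13t n t n≥39 h = +-cancelʳ-≤ (39 * (n * n)) _ _ (begin
  12 * (n * (n * n)) + 39 * (n * n)   ≤⟨ +-monoʳ-≤ (12 * (n * (n * n))) (*-monoˡ-≤ (n * n) n≥39) ⟩
  12 * (n * (n * n)) + n * (n * n)    ≡⟨ solve 1 (λ c → con 12 :* c :+ c := con 13 :* c) refl (n * (n * n)) ⟩
  13 * (n * (n * n))                  ≤⟨ *-monoʳ-≤ 13 h ⟩
  13 * (t + 3 * (n * n))              ≡⟨ solve 2 (λ t s → con 13 :* (t :+ con 3 :* s) := con 13 :* t :+ con 39 :* s) refl t (n * n) ⟩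
  13 * t + 39 * (n * n)               ∎)
  where open ≤-Reasoning

theorem6 : ∃[ N₀ ] ∀ (n : ℕ) → N₀ ≤ n →
    (numCycles 6 (cubeEdges n) ≤ 32 * exCycle 6 4 (cubeEdges n))
    × (80 * exCycle 6 4 (cubeEdges n) ≤ 13 * numCycles 6 (cubeEdges n))
theorem6 = 39 , λ n n≥39 → lower n , upper n n≥39
  where
  open ≤-Reasoning
  lower : ∀ n → numCycles 6 (cubeEdges n) ≤ 32 * exCycle 6 4 (cubeEdges n)
  lower n = begin
    numCycles 6 (cubeEdges n)
      ≤⟨ hexagons-lower n ⟩
    16 * (numCycles 6 (levels false n) + numCycles 6 (levels true n))
      ≤⟨ *-monoʳ-≤ 16 (+-mono-≤ (≤exCycle 6 4 (cubeEdges n) (levels∈sublists false n) (levels-cycleFree false n))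
                                (≤exCycle 6 4 (cubeEdges n) (levels∈sublists true n) (levels-cycleFree true n))) ⟩
    16 * (ex + ex)
      ≡⟨ solve 1 (λ x → con 16 :* (x :+ x) := con 32 :* x) refl ex ⟩
    32 * ex ∎
    where ex = exCycle 6 4 (cubeEdges n)
  upper : ∀ n → 39 ≤ n → 80 * exCycle 6 4 (cubeEdges n) ≤ 13 * numCycles 6 (cubeEdges n)
  upper n n≥39 = *-cancelˡ-≤ 3 (begin
    -- Combines 20 · `ex` ≤ n³V, 12n³ ≤ 13t and tV = 3N, where t is the number of ordered triples of
    -- distinct directions; the result is 240 · `ex` ≤ 39N.
    3 * (80 * ex)
      ≡⟨ solve 1 (λ x → con 3 :* (con 80 :* x) := con 12 :* (con 20 :* x)) refl ex ⟩
    12 * (20 * ex)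
      ≤⟨ *-monoʳ-≤ 12 (exCycle≤ 6 4 20 _ (cubeEdges n) hexagons-upper) ⟩
    12 * (n * (n * n) * V)
      ≡⟨ *-assoc 12 (n * (n * n)) V ⟨
    12 * (n * (n * n)) * V
      ≤⟨ *-monoˡ-≤ V (12n³≤13t n (length (triples n)) n≥39 (triples-lower n)) ⟩
    13 * length (triples n) * V
      ≡⟨ *-assoc 13 (length (triples n)) V ⟩
    13 * (length (triples n) * V)
      ≡⟨ cong (13 *_) (cube-hexagons n) ⟨
    13 * (3 * N)
      ≡⟨ solve 1 (λ x → con 13 :* (con 3 :* x) := con 3 :* (con 13 :* x)) refl N ⟩
    3 * (13 * N) ∎)
    where
    ex = exCycle 6 4 (cubeEdges n)
    N = numCycles 6 (cubeEdges n)
    V = length (allVertices n)
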